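{- Consider Algorithm 3 (described in the context) run on an M2VPI system $(G,c,\gamma)$. In each phase $k$ of Algorithm 3, the look-ahead Newton–Dinkelbach method invoked in that phase terminates in $O(|E(G^{(k)})|)$ iterations.
   Context: An M2VPI system is given by a directed multigraph $G=(V,E)$, $n=|V|$, $m=|E|$, arc costs $c\in\mathbb{R}^E$ and gain factors $\gamma\in\mathbb{R}^E_{>0}$; each arc $e=(v,w)$ encodes the constraint $y_v-\gamma_e y_w\le c_e$. $\delta^+(v)$, $\delta^-(v)$ denote outgoing/incoming arcs. For a walk $P$ with arcs $e_1,\dots,e_k$: $c(P):=\sum_{i=1}^k(\prod_{j<i}\gamma_{e_j})c_{e_i}$, $\gamma(P):=\prod_i\gamma_{e_i}$ (trivial walk: $c=0,\gamma=1$). A cycle at $u$ is a $u$-$u$ walk with distinct intermediate nodes; it is flow-absorbing if $\gamma(C)<1$. An arc $(v,w)$ is violated w.r.t. labels $y$ if $y_v>c_{vw}+\gamma_{vw}y_w$. Grapevine$(H,y,s)$: for a graph $H$ with costs/gains, labels $y$ (values in $\mathbb{R}\cup\{+\infty\}$) and node $s$: for rounds $i=1,\dots,n$, every node $v$ simultaneously computes $y'_v:=\min(y_v,\min_{vw\in\delta^+(v)}c_{vw}+\gamma_{vw}y_w)$, records $\mathrm{pred}(v,i)$ as a minimizing arc if $y'_v<y_v$ (else none), and then $y:=y'$. A walk $P$ from $s$ is traced by following recorded arcs in reverse chronological order starting from $\mathrm{pred}(s,n)$ (if $\mathrm{pred}(v,i)$ is none, $\mathrm{pred}(v,i-1)$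 is read). It returns $(y,P)$. For a node $u$ and a subgraph $H$, let $H_u$ be obtained by splitting $u$ into $u$ (keeping its outgoing arcs) and a new sink $u'$ receiving all arcs of $H$ entering $u$ (with the same costs and gains). Algorithm 3: initialize $y_v:=\infty$ for all $v$ and $G^{(0)}:=(V,\emptyset)$. Process the nodes $u\in V$ one by one; phase $k$: $G^{(k)}:=G^{(k-1)}\cup\delta^+(u)$ (outgoing arcs of $u$ in $G$); $y_u:=\min_{uv\in\delta^+(u)}c_{uv}+\gamma_{uv}y_v$; if $y_u=\infty$ and $G^{(k)}$ has a flow-absorbing cycle $C$ at $u$, set $y_u:=c(C)/(1-\gamma(C))$. If $y_u<\infty$: define $\bar y$ on $V\cup\{u'\}$ by $\bar y_{u'}:=y_u$, $\bar y_v:=y_v$; run $(\bar y,P):=$Grapevine$(G^{(k)}_u,\bar y,u)$; if some arc of $G^{(k)}_u$ is violated w.r.t. $\bar y$, or $P$ has at least one arc and $\gamma(P)\ge1$, return INFEASIBLE. Otherwise run the look-ahead Newton–Dinkelbach method on $f(\delta):=\inf_{x\in\mathcal{D}}\big(c^\top x+\delta\sum_{e\in\delta^-(u)}\gamma_ex_e-\delta\big)$, where $\mathcal{D}:=\{x\in\mathbb{R}^{E(G^{(k)})}_{\ge0}: x(\delta^+(u))=1,\ \nabla x_v=0\ \forall v\ne u\}$ and $\nabla x_v:=\sum_{e\in\delta^+(v)}x_e-\sum_{e\in\delta^-(v)}\gamma_ex_e$ (in $G^{(k)}$), with initial point $\bar y_{u'}$ and supergradient $\gamma(P)-1$; the value/supergradient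 oracle at $\delta$ sets $\bar y_{u'}:=\delta$ and runs Grapevine$(G^{(k)}_u,\bar y,u)$ (updating $\bar y$); then $f(\delta)=-\infty$ if an arc is violated, otherwise $f(\delta)=\bar y_u-\delta$ with supergradient $\gamma(P)-1$ if the returned walk $P$ ends at $u'$ and $-1$ otherwise. If the method returns NO ROOT, return INFEASIBLE; else set $y:=\bar y|_V$. After all phases return $y$. Look-ahead Newton–Dinkelbach method: from $(\delta^{(i)},g^{(i)})$ with $f(\delta^{(i)})\le0,g^{(i)}<0$: stop with $\delta^{(i)}$ if $f(\delta^{(i)})=0$; else $\delta:=\delta^{(i)}-f(\delta^{(i)})/g^{(i)}$, $g\in\partial f(\delta)$; return NO ROOT if $f(\delta)=-\infty$ or ($f(\delta)<0$ and $g\ge0$); $\delta':=2\delta-\delta^{(i)}$, $g'\in\partial f(\delta')$, and if $-\infty<f(\delta')<0$, $g'<0$ use $(\delta',g')$ instead; set $(\delta^{(i+1)},g^{(i+1)}):=(\delta,g)$. -}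

module Defs where

open import Algebra.Bundles using (CommutativeRing)
open import Data.Bool.Base using (if_then_else_)
open import Data.Empty.Polymorphic using () renaming (⊥ to ∅)
open import Data.Fin.Base using (Fin; zero; suc)
open import Data.Fin.Properties using (_≟_)
open import Data.Fin.Subset using (Subset; _∈_; _∉_; _∪_; ⁅_⁆; ⊥)
open import Data.Fin.Subset.Properties using (_∈?_)
open import Data.List.Base using (List; []; _∷_; foldr; map; filter; allFin)
open import Data.List.Relation.Unary.Unique.Propositional using (Unique)
open import Data.Maybe.Base as Maybe using (Maybe; just; nothing)
open import Data.Nat.Base as ℕ using (ℕ; zero; suc)
open import Data.Product.Base using (Σ; ∃; _×_; _,_)
open import Data.Unit.Polymorphic.Base using (⊤)
import Data.Vec.Base as Vec
open import Data.Vec.Functional using (Vector; updateAt)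
open import Function.Base using (_∘_; const)
open import Level using (Level; _⊔_) renaming (suc to lsuc)
open import Relation.Binary.Core using (Rel)
open import Relation.Binary.PropositionalEquality.Core using (_≡_; _≢_)
open import Relation.Binary.Structures using (IsStrictTotalOrder)
import Relation.Binary.Construct.Add.Supremum.Strict as SupremumStrict
open import Relation.Nullary.Construct.Add.Supremum using (_⁺; ⊤⁺; [_])
open import Relation.Nullary.Decidable.Core using (does; _×-dec_)
open import Relation.Nullary.Negation.Core using (¬_)

-- The algorithm only uses the operations and comparisons of an ordered field,
-- so the reals are replaced by an arbitrary one.  The value of _⁻¹ at 0# is
-- left unspecified.
record OrderedField (c ℓ₁ ℓ₂ : Level) : Set (lsuc (c ⊔ ℓ₁ ⊔ ℓ₂)) where
  infix 4 _<_ _≥_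
  infix 8 _⁻¹
  field
    commutativeRing : CommutativeRing c ℓ₁
  open CommutativeRing commutativeRing public
  field
    _<_                : Rel Carrier ℓ₂
    isStrictTotalOrder : IsStrictTotalOrder _≈_ _<_
    0<1                : 0# < 1#
    +-monoˡ-<          : ∀ z {x y} → x < y → x + z < y + z
    *-pos              : ∀ {x y} → 0# < x → 0# < y → 0# < x * y
    _⁻¹                : Carrier → Carrier
    ⁻¹-inverseʳ        : ∀ {x} → x ≉ 0# → x * x ⁻¹ ≈ 1#
  open IsStrictTotalOrder isStrictTotalOrder public using (compare; _<?_)

  _≥_ : Rel Carrier ℓ₂
  x ≥ y = ¬ (x < y)

module M2VPI {c ℓ₁ ℓ₂} (F : OrderedField c ℓ₁ ℓ₂) where
  open OrderedField F hiding (zero)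
  open SupremumStrict _<_ using (_<⁺_; <⁺-dec)

  -- Arc e = (v , w), with v = tail e and w = head e, encodes
  -- y v - gain e * y w ≤ cost e.
  record System (n m : ℕ) : Set (c ⊔ ℓ₂) where
    field
      tail head : Fin m → Fin n
      cost gain : Fin m → Carrier
      gain-pos  : ∀ e → 0# < gain e

  -- Carrier ⁺ is the field extended by +∞ = ⊤⁺.
  Labels : ℕ → Set c
  Labels n = Vector (Carrier ⁺) n

  infixl 7 _⊓_
  _⊓_ : Carrier ⁺ → Carrier ⁺ → Carrier ⁺
  x ⊓ y = if does (<⁺-dec _<?_ x y) then x else y

  -- A subgraph of a system on all of its nodes is given by its set of arcs S.
  module Subgraph {n m : ℕ} (G : System n m) (S : Subset m) where
    open System G

    IsWalk : Fin n → List (Fin m) → Fin n → Set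
    IsWalk v []       w = v ≡ w
    IsWalk v (e ∷ es) w = e ∈ S × tail e ≡ v × IsWalk (head e) es w

    walkGain : List (Fin m) → Carrier
    walkGain = foldr (λ e γ → gain e * γ) 1#

    -- The first argument is the product of the gains of the arcs already
    -- traversed.
    walkCostFrom : Carrier → List (Fin m) → Carrier
    walkCostFrom γ []       = 0#
    walkCostFrom γ (e ∷ es) = γ * cost e + walkCostFrom (γ * gain e) es

    walkCost : List (Fin m) → Carrier
    walkCost = walkCostFrom 1#

    endpoint : Fin n → List (Fin m) → Fin n
    endpoint v []       = v
    endpoint v (e ∷ es) = endpoint (head e) es

    -- The tails of the arcs of a closed walk at u are u and its intermediate
    -- nodes.
    IsCycle : Fin n → List (Fin m) → Set
    IsCycle u es = es ≢ [] × IsWalk u es u × Unique (map tail es)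

    IsFlowAbsorbingCycle : Fin n → List (Fin m) → Set ℓ₂
    IsFlowAbsorbingCycle u es = IsCycle u es × walkGain es < 1#

    arcValue : Labels n → Fin m → Carrier ⁺
    arcValue y e = Maybe.map (λ t → cost e + gain e * t) (y (head e))

    outArcs : Fin n → List (Fin m)
    outArcs v = filter (λ e → (e ∈? S) ×-dec (tail e ≟ v)) (allFin m)

    -- The minimum over an empty set of arcs is +∞.
    bestOut : Labels n → Fin n → Carrier ⁺
    bestOut y v = foldr _⊓_ ⊤⁺ (map (arcValue y) (outArcs v))

    Violated : Labels n → Fin m → Set (c ⊔ ℓ₂)
    Violated y e = e ∈ S × arcValue y e <⁺ y (tail e)

    HasViolatedArc : Labels n → Set (c ⊔ ℓ₂)
    HasViolatedArc y = ∃ (Violated y)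

    round : Labels n → Labels n
    round y v = y v ⊓ bestOut y v

    -- The labels after r rounds of Grapevine.
    grapevine : ℕ → Labels n → Labels n
    grapevine zero    y = y
    grapevine (suc r) y = round (grapevine r y)

    IsMinimizingArc : Labels n → Fin n → Fin m → Set (c ⊔ ℓ₂)
    IsMinimizingArc y v e = e ∈ S × tail e ≡ v ×
      (∀ e′ → e′ ∈ S → tail e′ ≡ v → ¬ (arcValue y e′ <⁺ arcValue y e))

    -- What one round, started with labels y, may record at v.
    data IsPred (y : Labels n) (v : Fin n) : Maybe (Fin m) → Set (c ⊔ ℓ₂) where
      improved : ∀ {e} → round y v <⁺ y v → IsMinimizingArc y v e → IsPred y v (just e)
      same     : ¬ (round y v <⁺ y v) → IsPred y v nothing

    -- pred i v is the record made at v in round i + 1.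
    trace : (ℕ → Fin n → Maybe (Fin m)) → ℕ → Fin n → List (Fin m)
    trace pred zero    v = []
    trace pred (suc i) v with pred i v
    ... | just e  = e ∷ trace pred i (head e)
    ... | nothing = trace pred i v

    -- P is a walk that r rounds of Grapevine from labels y may return at s;
    -- ties between minimizing arcs are broken arbitrarily.
    IsGrapevineWalk : ℕ → Labels n → Fin n → List (Fin m) → Set (c ⊔ ℓ₂)
    IsGrapevineWalk r y s P = Σ (ℕ → Fin n → Maybe (Fin m)) λ pred →
      (∀ i v → i ℕ.< r → IsPred (grapevine i y) v (pred i v)) × P ≡ trace pred r s

  data Answer : Set c where
    -∞    : Answer
    value : (f g : Carrier) → Answer

  -- The look-ahead Newton–Dinkelbach method for a function given by a
  -- value/supergradient oracle: Oracle μ δ a μ′ holds when the oracle with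
  -- memory μ may answer a to the query δ, its memory becoming μ′.
  module LookAheadNewton {a p} {Memory : Set a}
                         (Oracle : Memory → Carrier → Answer → Memory → Set p) where

    -- f is the function value and g the supergradient at the point δ.
    record State : Set (c ⊔ a) where
      constructor state
      field
        δ f g  : Carrier
        memory : Memory

    data Outcome : Set (c ⊔ a) where
      root     : Carrier → Memory → Outcome
      noRoot   : Outcome
      continue : State → Outcome

    newton : Carrier → Carrier → Carrier → Carrier
    newton δ f g = δ - f * g ⁻¹

    -- 2 δ₁ - δ₀
    lookAhead : Carrier → Carrier → Carrier
    lookAhead δ₁ δ₀ = (δ₁ + δ₁) - δ₀

    Fails : Answer → Set ℓ₂
    Fails -∞          = ⊤
    Fails (value f g) = f < 0# × g ≥ 0#

    Accepted : Answer → Set ℓ₂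
    Accepted -∞          = ∅
    Accepted (value f g) = f < 0# × g < 0#

    -- When the look-ahead point is rejected, the oracle's memory is that of
    -- the Newton point.
    data Iteration : State → Outcome → Set (c ⊔ ℓ₁ ⊔ ℓ₂ ⊔ a ⊔ p) where
      stop     : ∀ {δ f g μ} → f ≈ 0# → Iteration (state δ f g μ) (root δ μ)
      fail     : ∀ {δ f g μ b μ₁} → f ≉ 0# →
                 Oracle μ (newton δ f g) b μ₁ → Fails b →
                 Iteration (state δ f g μ) noRoot
      jump     : ∀ {δ f g μ f₁ g₁ μ₁ f₂ g₂ μ₂} → f ≉ 0# →
                 let δ₁ = newton δ f g ; δ₂ = lookAhead δ₁ δ in
                 Oracle μ δ₁ (value f₁ g₁) μ₁ → ¬ Fails (value f₁ g₁) →
                 Oracle μ₁ δ₂ (value f₂ g₂) μ₂ → Accepted (value f₂ g₂) →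
                 Iteration (state δ f g μ) (continue (state δ₂ f₂ g₂ μ₂))
      step     : ∀ {δ f g μ f₁ g₁ μ₁ b μ₂} → f ≉ 0# →
                 let δ₁ = newton δ f g ; δ₂ = lookAhead δ₁ δ in
                 Oracle μ δ₁ (value f₁ g₁) μ₁ → ¬ Fails (value f₁ g₁) →
                 Oracle μ₁ δ₂ b μ₂ → ¬ Accepted b →
                 Iteration (state δ f g μ) (continue (state δ₁ f₁ g₁ μ₁))

    data ReturnsRoot : State → Carrier → Memory → Set (c ⊔ ℓ₁ ⊔ ℓ₂ ⊔ a ⊔ p) where
      now   : ∀ {s δ μ} → Iteration s (root δ μ) → ReturnsRoot s δ μ
      later : ∀ {s s′ δ μ} → Iteration s (continue s′) → ReturnsRoot s′ δ μ → ReturnsRoot s δ μ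

    -- Whatever choices the oracle makes, the method can always proceed and
    -- terminates after at most k iterations.
    data TerminatesWithin : ℕ → State → Set (c ⊔ ℓ₁ ⊔ ℓ₂ ⊔ a ⊔ p) where
      iterate : ∀ {k s} → ∃ (Iteration s) →
                (∀ {s′} → Iteration s (continue s′) → TerminatesWithin k s′) →
                TerminatesWithin (suc k) s

  module Algorithm {n m : ℕ} (G : System n m) where
    open System G

    δ⁺ : Fin n → Subset m
    δ⁺ u = Vec.tabulate (λ e → does (tail e ≟ u))

    -- Node zero is the new sink u′; node suc v is the node v of G.
    split : Fin n → System (suc n) m
    split u = record
      { tail     = suc ∘ tail
      ; head     = λ e → if does (head e ≟ u) then zero else suc (head e)
      ; cost     = cost
      ; gain     = gain
      ; gain-pos = gain-pos
      }

    -- Phase of node u, where S is the arc set of the current graph, already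
    -- containing the outgoing arcs of u.
    module Phase (S : Subset m) (u : Fin n) where
      private
        module H  = Subgraph G S
        module Hᵤ = Subgraph (split u) S

      data InitialLabel (y : Labels n) : Carrier ⁺ → Set (c ⊔ ℓ₂) where
        finite    : ∀ {t} → H.bestOut y u ≡ [ t ] → InitialLabel y [ t ]
        cycle     : ∀ {C} → H.bestOut y u ≡ ⊤⁺ → H.IsFlowAbsorbingCycle u C →
                    InitialLabel y [ H.walkCost C * (1# - H.walkGain C) ⁻¹ ]
        unbounded : H.bestOut y u ≡ ⊤⁺ → ¬ ∃ (H.IsFlowAbsorbingCycle u) →
                    InitialLabel y ⊤⁺

      setSink : Carrier → Labels (suc n) → Labels (suc n)
      setSink δ ȳ = updateAt ȳ zero (const [ δ ])

      -- The number of rounds is the number n of nodes of G.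
      run : Labels (suc n) → Labels (suc n)
      run = Hᵤ.grapevine n

      RunWalk : Labels (suc n) → List (Fin m) → Set (c ⊔ ℓ₂)
      RunWalk ȳ = Hᵤ.IsGrapevineWalk n ȳ (suc u)

      slope : List (Fin m) → Carrier
      slope P = if does (Hᵤ.endpoint (suc u) P ≟ zero) then Hᵤ.walkGain P - 1# else - 1#

      -- Value and supergradient at δ of
      --   f(δ) = inf { cᵀx + δ Σ_{e ∈ δ⁻(u)} γₑxₑ - δ : x ∈ 𝒟 },
      -- as the algorithm evaluates them.
      data Oracle (ȳ : Labels (suc n)) (δ : Carrier) :
                  Answer → Labels (suc n) → Set (c ⊔ ℓ₂) where
        infinite : let ȳ₀ = setSink δ ȳ in
                   Hᵤ.HasViolatedArc (run ȳ₀) →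
                   Oracle ȳ δ -∞ (run ȳ₀)
        finite   : let ȳ₀ = setSink δ ȳ in
                   ∀ {t P} → ¬ Hᵤ.HasViolatedArc (run ȳ₀) →
                   run ȳ₀ (suc u) ≡ [ t ] → RunWalk ȳ₀ P →
                   Oracle ȳ δ (value (t - δ) (slope P)) (run ȳ₀)

      open LookAheadNewton Oracle public

      -- y on V, with u relabelled b and b also on the sink.
      extend : Labels n → Carrier → Labels (suc n)
      extend y b zero    = [ b ]
      extend y b (suc v) = updateAt y u (const [ b ]) v

      -- From labels y, the phase calls the Newton–Dinkelbach method in the
      -- given state.
      data Invokes (y : Labels n) : State → Set (c ⊔ ℓ₂) where
        invoke : ∀ {b t P} → InitialLabel y [ b ] →
                 let ȳ₀ = extend y b ; ȳ = run ȳ₀ in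
                 RunWalk ȳ₀ P →
                 ¬ Hᵤ.HasViolatedArc ȳ →
                 ¬ (P ≢ [] × Hᵤ.walkGain P ≥ 1#) →
                 ȳ (suc u) ≡ [ t ] →
                 Invokes y (state b (t - b) (Hᵤ.walkGain P - 1#) ȳ)

      -- The phase ends, without reporting infeasibility, with the given labels.
      data Completes (y : Labels n) : Labels n → Set (c ⊔ ℓ₁ ⊔ ℓ₂) where
        skip  : InitialLabel y ⊤⁺ → Completes y (updateAt y u (const ⊤⁺))
        solve : ∀ {s δ ȳ} → Invokes y s → ReturnsRoot s δ ȳ → Completes y (ȳ ∘ suc)

    -- Reached A S y: after some number of phases the algorithm has processed
    -- exactly the nodes in A, in any order, and holds the graph with arc set S
    -- and the labels y.
    data Reached : Subset n → Subset m → Labels n → Set (c ⊔ ℓ₁ ⊔ ℓ₂) where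
      start : Reached ⊥ ⊥ (const ⊤⁺)
      phase : ∀ {A S y y′ u} → Reached A S y → u ∉ A →
              Phase.Completes (S ∪ δ⁺ u) u y y′ →
              Reached (A ∪ ⁅ u ⁆) (S ∪ δ⁺ u) y′

{-# OPTIONS --safe #-}

-- Each successful oracle call yields labels without violated arcs together
-- with a walk P from u to u′ whose arcs are tight.  Let Z be the last iterate
-- with negative value and slope, and let D(X) be the Bregman divergence from
-- an earlier iterate X to Z; it equals the sum, over the arcs e of the walk of
-- X, of the reduced cost of e under the labels of Z times the gain of the part
-- of the walk before e.  The look-ahead makes D shrink by a factor 2/3 every two
-- iterations.  The gain of the part before e only grows from one use of e to
-- the next, so D(X) is at most the sum of the divergences at the last uses of
-- the arcs of the walk of X.  Since divergences decay geometrically, charging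
-- each iteration to these last uses bounds the number of iterations by a
-- multiple of the number of arcs.
module Submission where

open import Defs
import Algebra.Properties.AbelianGroup as AbelianGroupProperties
import Algebra.Properties.CommutativeMonoid.Sum as CommutativeMonoidSum
import Algebra.Properties.Ring as RingProperties
import Algebra.Properties.Semiring.Mult as SemiringMultiples
import Algebra.Properties.Semiring.Mult.TCOptimised as SemiringMult
import Algebra.Properties.Semiring.Sum as SemiringSum
import Algebra.Solver.Ring as RingSolver
open import Algebra.Bundles using (CommutativeRing)
open import Algebra.Solver.Ring.AlmostCommutativeRing using (fromCommutativeRing; _-Raw-AlmostCommutative⟶_)
open import Data.Fin.Base as Fin using (Fin; zero; suc; punchOut)
open import Data.Fin.Properties using (_≟_; any?; pigeonhole; punchOut-injective)
open import Data.Fin.Subset using (Subset; inside; outside; _∈_; _∉_; _∪_; ∣_∣)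
open import Data.Fin.Subset.Properties using (_∈?_; drop-there; x∈p∪q⁻; x∈p⇒∣p-x∣<∣p∣; ∉⊥)
open import Data.Integer.Base as ℤ using (ℤ; +_; -[1+_])
import Data.Integer.Properties as ℤ
open import Data.List.Base using (List; []; _∷_; _++_; foldr; map; allFin)
import Data.List.Membership.DecPropositional as DecMembership
import Data.List.Membership.Propositional as List
open import Data.List.Membership.Propositional.Properties using (∈-filter⁺; ∈-filter⁻; ∈-allFin; ∈-∃++; ∈-++⁺ʳ)
open import Data.List.Relation.Unary.All as All using (All; []; _∷_)
open import Data.List.Relation.Unary.All.Properties using (++⁻ˡ; ++⁻ʳ)
open import Data.List.Relation.Unary.AllPairs using ([]; _∷_)
open import Data.List.Relation.Unary.Any using (here; there)
open import Data.List.Relation.Unary.Unique.Propositional using (Unique)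
open import Data.Maybe.Base as Maybe using (Maybe; just; nothing; fromMaybe)
open import Data.Nat.Base as ℕ using (ℕ)
import Data.Nat.Properties as ℕ
open import Data.Nat.Solver using (module +-*-Solver)
open import Data.Product.Base using (∃; ∃-syntax; _×_; _,_; proj₁; proj₂)
open import Data.Sign.Base as Sign using (Sign)
open import Data.Sum.Base using (_⊎_; inj₁; inj₂)
open import Data.Vec.Base using ([]; _∷_; here; there)
open import Data.Vec.Functional using (Vector; updateAt)
open import Data.Vec.Functional.Properties using (updateAt-minimal; updateAt-updates)
open import Data.Vec.Properties using (lookup∘tabulate; []=⇒lookup)
open import Function.Base using (_∘_; const)
open import Level using (Level; _⊔_)
open import Relation.Binary.Core using (Rel)
import Relation.Binary.Construct.Add.Supremum.NonStrict as SupremumNonStrict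
import Relation.Binary.Construct.Add.Supremum.Strict as SupremumStrict
open import Relation.Binary.Definitions using (tri<; tri≈; tri>)
open import Relation.Binary.PropositionalEquality.Core as ≡ using (_≡_; _≢_)
import Relation.Binary.Reasoning.Setoid as SetoidReasoning
open import Relation.Binary.Structures using (IsStrictTotalOrder)
open import Relation.Nullary.Construct.Add.Supremum using (_⁺; ⊤⁺; [_])
open import Relation.Nullary.Decidable.Core using (Dec; yes; no; does; _×-dec_; ¬?; decidable-stable)
open import Relation.Nullary.Negation.Core using (¬_; contradiction)
open +-*-Solver using () renaming (solve to ℕ-solve; con to conⁿ; _:*_ to _:*ⁿ_; _:+_ to _:+ⁿ_; _:=_ to _:=ⁿ_)

-- Oracle answers are kept as tangents, and the nonnegativity of reduced costs under the labels of
-- another snapshot replaces concavity. The reference point is an iterate `Z` and not a root,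
-- because a root need not exist; the negative value of `Z` makes all earlier divergences positive.
-- The delicate case is a look-ahead point rejected with `-∞`. This answer only says that n rounds,
-- started from the labels left by earlier queries, did not settle, yet it has to imply that no
-- later negative iterate lies below that point. Such an iterate would supply feasible labels under
-- the start labels, while the Newton point supplies feasible labels above them; between two
-- feasible labellings n rounds suffice, whatever the gains of the cycles. The constants: in units
-- of the current divergence D, an arc recorded with w has credit 3 - 2w/D, at most 3. Going back
-- two iterations raises the total credit by at least 1, so there are at most 3|S| such pairs.
-- Boundary iterations lead to 6|S| + 4, which is at most 10|S|.

-- A ring solver with integer constants.

module IntegerCoefficients {c ℓ} (R : CommutativeRing c ℓ) where
  open CommutativeRing R
  open AbelianGroupProperties +-abelianGroup using (⁻¹-∙-comm)
  open RingProperties ring using (-‿distribˡ-*; -‿distribʳ-*; -‿involutive; -0#≈0#)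
  open SemiringMult semiring using (×-homo-+; ×1-homo-*; 1+×) renaming (_×_ to _·_)
  open SetoidReasoning setoid

  -- The optimised multiples reduce `1 · 1#` to `1#`, so the constants 0 and 1 in solved identities
  -- agree with the goals definitionally.
  fromℤ : ℤ → Carrier
  fromℤ (+ n)    = n · 1#
  fromℤ -[1+ n ] = - (ℕ.suc n · 1#)

  private
    cancel : ∀ x y z → (x + y) + - (x + z) ≈ y + - z
    cancel x y z = begin
      (x + y) + - (x + z)     ≈⟨ +-cong (+-comm x y) (sym (⁻¹-∙-comm x z)) ⟩
      (y + x) + (- x + - z)   ≈⟨ +-assoc y x _ ⟩
      y + (x + (- x + - z))   ≈⟨ +-congˡ (sym (+-assoc x (- x) (- z))) ⟩
      y + ((x + - x) + - z)   ≈⟨ +-congˡ (+-congʳ (-‿inverseʳ x)) ⟩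
      y + (0# + - z)          ≈⟨ +-congˡ (+-identityˡ _) ⟩
      y + - z                 ∎

    signed : Sign → Carrier → Carrier
    signed Sign.+ x = x
    signed Sign.- x = - x

    fromℤ-◃ : ∀ s n → fromℤ (s ℤ.◃ n) ≈ signed s (n · 1#)
    fromℤ-◃ Sign.+ ℕ.zero    = refl
    fromℤ-◃ Sign.+ (ℕ.suc n) = refl
    fromℤ-◃ Sign.- ℕ.zero    = sym -0#≈0#
    fromℤ-◃ Sign.- (ℕ.suc n) = refl

    fromℤ-sign-abs : ∀ i → fromℤ i ≡ signed (ℤ.sign i) (ℤ.∣ i ∣ · 1#)
    fromℤ-sign-abs (+ n)    = ≡.refl
    fromℤ-sign-abs -[1+ n ] = ≡.refl

    signed-* : ∀ s t x y → signed (s Sign.* t) (x * y) ≈ signed s x * signed t y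
    signed-* Sign.+ Sign.+ x y = refl
    signed-* Sign.+ Sign.- x y = -‿distribʳ-* x y
    signed-* Sign.- Sign.+ x y = -‿distribˡ-* x y
    signed-* Sign.- Sign.- x y = begin
      x * y         ≈⟨ sym (-‿involutive _) ⟩
      - - (x * y)   ≈⟨ -‿cong (-‿distribˡ-* x y) ⟩
      - (- x * y)   ≈⟨ -‿distribʳ-* (- x) y ⟩
      - x * - y     ∎

    signed-cong : ∀ s {x y} → x ≈ y → signed s x ≈ signed s y
    signed-cong Sign.+ p = p
    signed-cong Sign.- p = -‿cong p

    fromℤ-⊖ : ∀ m n → fromℤ (m ℤ.⊖ n) ≈ m · 1# + - (n · 1#)
    fromℤ-⊖ m ℕ.zero = sym (trans (+-congˡ -0#≈0#) (+-identityʳ _))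
    fromℤ-⊖ ℕ.zero (ℕ.suc n) = sym (+-identityˡ _)
    fromℤ-⊖ (ℕ.suc m) (ℕ.suc n) = begin
      fromℤ (ℕ.suc m ℤ.⊖ ℕ.suc n)         ≡⟨ ≡.cong fromℤ (ℤ.[1+m]⊖[1+n]≡m⊖n m n) ⟩
      fromℤ (m ℤ.⊖ n)                     ≈⟨ fromℤ-⊖ m n ⟩
      m · 1# + - (n · 1#)                 ≈⟨ sym (cancel 1# _ _) ⟩
      (1# + m · 1#) + - (1# + n · 1#)     ≈⟨ sym (+-cong (1+× m 1#) (-‿cong (1+× n 1#))) ⟩
      ℕ.suc m · 1# + - (ℕ.suc n · 1#)     ∎

  fromℤ-homo-+ : ∀ i j → fromℤ (i ℤ.+ j) ≈ fromℤ i + fromℤ j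
  fromℤ-homo-+ (+ m)    (+ n)    = ×-homo-+ 1# m n
  fromℤ-homo-+ (+ m)    -[1+ n ] = fromℤ-⊖ m (ℕ.suc n)
  fromℤ-homo-+ -[1+ m ] (+ n)    = trans (fromℤ-⊖ n (ℕ.suc m)) (+-comm _ _)
  fromℤ-homo-+ -[1+ m ] -[1+ n ] = begin
    - (ℕ.suc (ℕ.suc (m ℕ.+ n)) · 1#)              ≡⟨ ≡.cong (λ k → - (ℕ.suc k · 1#)) (≡.sym (ℕ.+-suc m n)) ⟩
    - ((ℕ.suc m ℕ.+ ℕ.suc n) · 1#)                ≈⟨ -‿cong (×-homo-+ 1# (ℕ.suc m) (ℕ.suc n)) ⟩
    - (ℕ.suc m · 1# + ℕ.suc n · 1#)               ≈⟨ sym (⁻¹-∙-comm _ _) ⟩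
    - (ℕ.suc m · 1#) + - (ℕ.suc n · 1#)           ∎

  fromℤ-homo-* : ∀ i j → fromℤ (i ℤ.* j) ≈ fromℤ i * fromℤ j
  fromℤ-homo-* i j = begin
    fromℤ (s ℤ.◃ ℤ.∣ i ∣ ℕ.* ℤ.∣ j ∣)                 ≈⟨ fromℤ-◃ s (ℤ.∣ i ∣ ℕ.* ℤ.∣ j ∣) ⟩
    signed s ((ℤ.∣ i ∣ ℕ.* ℤ.∣ j ∣) · 1#)             ≈⟨ signed-cong s (×1-homo-* ℤ.∣ i ∣ ℤ.∣ j ∣) ⟩
    signed s ((ℤ.∣ i ∣ · 1#) * (ℤ.∣ j ∣ · 1#))        ≈⟨ signed-* (ℤ.sign i) (ℤ.sign j) _ _ ⟩
    signed (ℤ.sign i) _ * signed (ℤ.sign j) _         ≡⟨ ≡.cong₂ _*_ (≡.sym (fromℤ-sign-abs i)) (≡.sym (fromℤ-sign-abs j)) ⟩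
    fromℤ i * fromℤ j                                 ∎
    where s = ℤ.sign i Sign.* ℤ.sign j

  fromℤ-homo-neg : ∀ i → fromℤ (ℤ.- i) ≈ - fromℤ i
  fromℤ-homo-neg (+ ℕ.zero)  = sym -0#≈0#
  fromℤ-homo-neg (+ ℕ.suc n) = refl
  fromℤ-homo-neg -[1+ n ]    = sym (-‿involutive _)

  private
    morphism : ℤ.+-*-rawRing -Raw-AlmostCommutative⟶ fromCommutativeRing R
    morphism = record
      { ⟦_⟧    = fromℤ
      ; +-homo = fromℤ-homo-+
      ; *-homo = fromℤ-homo-*
      ; -‿homo = fromℤ-homo-neg
      ; 0-homo = refl
      ; 1-homo = refl
      }

    decide : ∀ i j → Maybe (fromℤ i ≈ fromℤ j)
    decide i j with i ℤ.≟ j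
    ... | yes p = just (reflexive (≡.cong fromℤ p))
    ... | no  _ = nothing

  module Solver = RingSolver ℤ.+-*-rawRing (fromCommutativeRing R) morphism decide

-- Order and sign rules in an ordered field.

module OrderedFieldProperties {c ℓ₁ ℓ₂} (F : OrderedField c ℓ₁ ℓ₂) where
  open OrderedField F
  open IsStrictTotalOrder isStrictTotalOrder using (<-respˡ-≈; <-respʳ-≈)
    renaming (trans to <-trans; irrefl to <-irrefl; asym to <-asym) public
  open IntegerCoefficients commutativeRing
  open Solver

  infix 4 _≤_
  _≤_ : Rel Carrier ℓ₂
  x ≤ y = y ≥ x

  ≤-reflexive : ∀ {x y} → x ≈ y → x ≤ y
  ≤-reflexive x≈y y<x = <-irrefl (sym x≈y) y<x

  <⇒≤ : ∀ {x y} → x < y → x ≤ y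
  <⇒≤ = <-asym

  ≤-<-trans : ∀ {x y z} → x ≤ y → y < z → x < z
  ≤-<-trans {x} {y} {z} x≤y y<z with compare x y
  ... | tri< x<y _ _ = <-trans x<y y<z
  ... | tri≈ _ x≈y _ = <-respˡ-≈ (sym x≈y) y<z
  ... | tri> _ _ y<x = contradiction y<x x≤y

  <-≤-trans : ∀ {x y z} → x < y → y ≤ z → x < z
  <-≤-trans {x} {y} {z} x<y y≤z with compare y z
  ... | tri< y<z _ _ = <-trans x<y y<z
  ... | tri≈ _ y≈z _ = <-respʳ-≈ y≈z x<y
  ... | tri> _ _ z<y = contradiction z<y y≤z

  ≤-trans : ∀ {x y z} → x ≤ y → y ≤ z → x ≤ z
  ≤-trans x≤y y≤z z<x = y≤z (<-≤-trans z<x x≤y)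

  ≤-antisym : ∀ {x y} → x ≤ y → y ≤ x → x ≈ y
  ≤-antisym {x} {y} x≤y y≤x with compare x y
  ... | tri< x<y _ _ = contradiction x<y y≤x
  ... | tri≈ _ x≈y _ = x≈y
  ... | tri> _ _ y<x = contradiction y<x x≤y

  ≤∧≉⇒< : ∀ {x y} → x ≤ y → x ≉ y → x < y
  ≤∧≉⇒< {x} {y} x≤y x≉y with compare x y
  ... | tri< x<y _ _ = x<y
  ... | tri≈ _ x≈y _ = contradiction x≈y x≉y
  ... | tri> _ _ y<x = contradiction y<x x≤y

  0≤-resp-≈ : ∀ {x y} → x ≈ y → 0# ≤ x → 0# ≤ y
  0≤-resp-≈ x≈y 0≤x y<0 = 0≤x (<-respˡ-≈ (sym x≈y) y<0)

  <⇒0<- : ∀ {x y} → x < y → 0# < y - x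
  <⇒0<- {x} x<y = <-respˡ-≈ (-‿inverseʳ x) (+-monoˡ-< (- x) x<y)

  0<-⇒< : ∀ {x y} → 0# < y - x → x < y
  0<-⇒< {x} {y} p = <-respˡ-≈ (+-identityˡ x)
    (<-respʳ-≈ (solve 2 (λ x y → y :- x :+ x := y) refl x y) (+-monoˡ-< x p))

  ≤⇒0≤- : ∀ {x y} → x ≤ y → 0# ≤ y - x
  ≤⇒0≤- {x} {y} x≤y p = x≤y (0<-⇒< (<-respʳ-≈
    (solve 2 (λ x y → con (+ 0) :- (y :- x) := x :- y) refl x y) (<⇒0<- p)))

  0≤-⇒≤ : ∀ {x y} → 0# ≤ y - x → x ≤ y
  0≤-⇒≤ {x} {y} p y<x = p (0<-⇒< (<-respʳ-≈
    (solve 2 (λ x y → x :- y := con (+ 0) :- (y :- x)) refl x y) (<⇒0<- y<x)))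

  -- Inequalities are proved by certificates: y - x is exhibited as an
  -- expression whose sign is known.
  ≤-by : ∀ {x y p} → 0# ≤ p → y - x ≈ p → x ≤ y
  ≤-by 0≤p eq = 0≤-⇒≤ (0≤-resp-≈ (sym eq) 0≤p)

  <-by : ∀ {x y p} → 0# < p → y - x ≈ p → x < y
  <-by 0<p eq = 0<-⇒< (<-respʳ-≈ (sym eq) 0<p)

  0<+0≤ : ∀ {x y} → 0# < x → 0# ≤ y → 0# < x + y
  0<+0≤ {x} {y} 0<x 0≤y = ≤-<-trans 0≤y
    (<-respˡ-≈ (+-identityˡ y) (+-monoˡ-< y 0<x))

  0≤+0≤ : ∀ {x y} → 0# ≤ x → 0# ≤ y → 0# ≤ x + y
  0≤+0≤ {x} {y} 0≤x 0≤y = ≤-trans 0≤y (≤-by 0≤x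
    (solve 2 (λ x y → x :+ y :- y := x) refl x y))

  0≤*0≤ : ∀ {x y} → 0# ≤ x → 0# ≤ y → 0# ≤ x * y
  0≤*0≤ {x} {y} 0≤x 0≤y with compare 0# x | compare 0# y
  ... | tri< 0<x _ _ | tri< 0<y _ _ = <⇒≤ (*-pos 0<x 0<y)
  ... | tri≈ _ 0≈x _ | _            = ≤-reflexive (trans (sym (zeroˡ y)) (*-congʳ 0≈x))
  ... | _            | tri≈ _ 0≈y _ = ≤-reflexive (trans (sym (zeroʳ x)) (*-congˡ 0≈y))
  ... | tri> _ _ x<0 | _            = contradiction x<0 0≤x
  ... | _            | tri> _ _ y<0 = contradiction y<0 0≤y

  0≤*⇒0≤ : ∀ {x y} → 0# < x → 0# ≤ x * y → 0# ≤ y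
  0≤*⇒0≤ {x} {y} 0<x 0≤xy y<0 = 0≤xy (0<-⇒< (<-respʳ-≈
    (solve 2 (λ x y → x :* (con (+ 0) :- y) := con (+ 0) :- x :* y) refl x y)
    (*-pos 0<x (<⇒0<- y<0))))

  0<*⇒0< : ∀ {x y} → 0# < x → 0# < x * y → 0# < y
  0<*⇒0< {x} {y} 0<x 0<xy = ≤∧≉⇒< (0≤*⇒0≤ 0<x (<⇒≤ 0<xy))
    λ 0≈y → <-irrefl (trans (sym (zeroʳ x)) (*-congˡ 0≈y)) 0<xy

-- Tangents of a concave function and the decrease of their divergences.

module Tangents {c ℓ₁ ℓ₂} (F : OrderedField c ℓ₁ ℓ₂) where
  open OrderedField F
  open OrderedFieldProperties F
  open IntegerCoefficients commutativeRing
  open Solver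

  record Tangent : Set c where
    constructor tangent
    field
      point value slope : Carrier
  open Tangent

  Negative : Tangent → Set ℓ₂
  Negative X = value X < 0# × slope X < 0#

  -- The Bregman divergence, when X is a tangent of a concave function whose
  -- value at point Z is value Z.
  divergence : Tangent → Tangent → Carrier
  divergence X Z = value X + slope X * (point Z - point X) - value Z

  private
    neg : ∀ {x} → x < 0# → 0# ≤ - x
    neg {x} x<0 = 0≤-resp-≈ (solve 1 (λ x → con (+ 0) :- x := :- x) refl x) (≤⇒0≤- (<⇒≤ x<0))

    neg< : ∀ {x} → x < 0# → 0# < - x
    neg< {x} x<0 = <-respʳ-≈ (solve 1 (λ x → con (+ 0) :- x := :- x) refl x) (<⇒0<- x<0)

  -- Adding the two divergences cancels the values and leaves (point X - point Y) * (slope Y - slope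
  -- X).
  slope-antitone : ∀ {X Y} → 0# ≤ divergence X Y → 0# ≤ divergence Y X →
                   point Y < point X → slope X ≤ slope Y
  slope-antitone {tangent δ f g} {tangent δ′ f′ g′} p q δ′<δ =
    0≤-⇒≤ (0≤*⇒0≤ (<⇒0<- δ′<δ) (0≤-resp-≈
      (solve 6 (λ δ f g δ′ f′ g′ →
         (f :+ g :* (δ′ :- δ) :- f′) :+ (f′ :+ g′ :* (δ :- δ′) :- f)
         := (δ :- δ′) :* (g′ :- g)) refl δ f g δ′ f′ g′)
      (0≤+0≤ p q)))

  value-antitone : ∀ {Y Z} → 0# ≤ divergence Z Y → slope Z < 0# →
                   point Z ≤ point Y → value Y ≤ value Z
  value-antitone {tangent δ f g} {tangent d φ ψ} p ψ<0 d≤δ =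
    ≤-by (0≤+0≤ p (0≤*0≤ (neg ψ<0) (≤⇒0≤- d≤δ)))
      (solve 6 (λ δ f g d φ ψ →
         φ :- f := (φ :+ ψ :* (δ :- d) :- f) :+ (:- ψ) :* (δ :- d)) refl δ f g d φ ψ)

  -- The tangent at `Z` falls to the right and lies above the value at `X`, and slopes only get
  -- smaller to the right. Used backwards: a finite look-ahead point that is rejected has no
  -- negative iterate to its left.
  negative-before : ∀ {X Z} → 0# ≤ divergence X Z → 0# ≤ divergence Z X →
                    point Z < point X → Negative Z → Negative X
  negative-before {X} {Z} p q Z<X (φ<0 , ψ<0) =
    ≤-<-trans (value-antitone {X} {Z} q ψ<0 (<⇒≤ Z<X)) φ<0 ,
    ≤-<-trans (slope-antitone {X} {Z} p q Z<X) ψ<0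

  -- Division-free: `h` stands for value X / slope X, so the Newton point is point X - h. In
  -- `DoubleStep` the point of `Y` is the look-ahead point, twice as far.
  record NewtonStep (h : Carrier) (X Y : Tangent) : Set ℓ₁ where
    constructor newtonStep
    field
      point≈ : point X ≈ point Y + h
      value≈ : value X ≈ h * slope X

  record DoubleStep (h : Carrier) (X Y : Tangent) : Set ℓ₁ where
    constructor doubleStep
    field
      point≈ : point X ≈ point Y + (h + h)
      value≈ : value X ≈ h * slope X

  -- The tangent at `X` vanishes at the Newton point, so it can be written from `point Y` without
  -- the value of `X`.
  divergence-step : ∀ {h X Y} → NewtonStep h X Y → ∀ Z →
                    divergence X Z ≈ slope X * (point Z - point Y) - value Z
  divergence-step {h} {tangent δ f g} {tangent δ₁ f₁ g₁} (newtonStep p q) (tangent d φ _) = trans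
    (+-congʳ (+-cong q (*-congˡ (+-congˡ (-‿cong p)))))
    (solve 5 (λ h g δ₁ d φ → h :* g :+ g :* (d :- (δ₁ :+ h)) :- φ := g :* (d :- δ₁) :- φ)
       refl h g δ₁ d φ)

  divergence-double : ∀ {h X Y} → DoubleStep h X Y → ∀ Z →
                      divergence X Z ≈ slope X * (point Z - point Y) - h * slope X - value Z
  divergence-double {h} {tangent δ f g} {tangent δ₁ f₁ g₁} (doubleStep p q) (tangent d φ _) = trans
    (+-congʳ (+-cong q (*-congˡ (+-congˡ (-‿cong p)))))
    (solve 5 (λ h g δ₁ d φ → h :* g :+ g :* (d :- (δ₁ :+ (h :+ h))) :- φ
                             := g :* (d :- δ₁) :- h :* g :- φ)
       refl h g δ₁ d φ)

  -- The tangent at `X` is zero at `point Y` and lies above `value Y`.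
  newton-value≤0 : ∀ {h X Y} → NewtonStep h X Y → 0# ≤ divergence X Y → value Y ≤ 0#
  newton-value≤0 {h} {X} {Y} s p = ≤-by p (trans
    (solve 3 (λ g δ f → con (+ 0) :- f := g :* (δ :- δ) :- f) refl (slope X) (point Y) (value Y))
    (sym (divergence-step s Y)))

  -- To the left of its zero at the Newton point the tangent at `X` is nonnegative, while `value Z`
  -- is negative.
  step-divergence-pos : ∀ {h X Y Z} → NewtonStep h X Y → Negative X → Negative Z →
                        point Z ≤ point Y → 0# < divergence X Z
  step-divergence-pos {h} {X} {Y} {Z} s (_ , g<0) (φ<0 , _) Z≤Y =
    <-respʳ-≈ (trans (solve 4 (λ g d δ φ → (:- φ) :+ (:- g) :* (δ :- d) := g :* (d :- δ) :- φ)
                        refl (slope X) (point Z) (point Y) (value Z))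
                     (sym (divergence-step s Z)))
      (0<+0≤ (neg< φ<0) (0≤*0≤ (neg g<0) (≤⇒0≤- Z≤Y)))

  double-divergence-pos : ∀ {h X Y Z} → DoubleStep h X Y → Negative X → Negative Z →
                          point Z ≤ point Y → 0# < divergence X Z
  double-divergence-pos {h} {X} {Y} {Z} s (f<0 , g<0) (φ<0 , _) Z≤Y =
    <-respʳ-≈ (trans (solve 5 (λ h g d δ φ → ((:- φ) :+ (:- (h :* g))) :+ (:- g) :* (δ :- d)
                                             := g :* (d :- δ) :- h :* g :- φ)
                        refl h (slope X) (point Z) (point Y) (value Z))
                     (sym (divergence-double s Z)))
      (0<+0≤ (0<+0≤ (neg< φ<0) (neg (<-respˡ-≈ (DoubleStep.value≈ s) f<0)))
             (0≤*0≤ (neg g<0) (≤⇒0≤- Z≤Y)))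

  -- At `point Y` the tangent of `X` is zero and that of `Y` is `value Y`; since `slope Y` is at
  -- least `slope X`, this gap can only widen to the left.
  step-divergence : ∀ {h X Y Z} → NewtonStep h X Y → slope X ≤ slope Y →
                    point Z ≤ point Y → divergence Y Z - value Y ≤ divergence X Z
  step-divergence {h} {X} {tangent δ₁ f₁ g₁} {tangent d φ ψ} s g≤g₁ Z≤Y =
    ≤-by (0≤*0≤ (≤⇒0≤- g≤g₁) (≤⇒0≤- Z≤Y))
      (trans (+-congʳ (divergence-step s (tangent d φ ψ)))
        (solve 6 (λ g d δ₁ φ f₁ g₁ →
           (g :* (d :- δ₁) :- φ) :- ((f₁ :+ g₁ :* (d :- δ₁) :- φ) :- f₁)
           := (g₁ :- g) :* (δ₁ :- d)) refl (slope X) d δ₁ φ f₁ g₁))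

  step-divergence-≤ : ∀ {h X Y Z} → NewtonStep h X Y → slope X ≤ slope Y → Negative Y →
                      point Z ≤ point Y → divergence Y Z ≤ divergence X Z
  step-divergence-≤ {h} {X} {Y} {Z} s g≤g₁ (f₁<0 , _) Z≤Y =
    ≤-trans (≤-by (neg f₁<0) (solve 2 (λ D f → D :- f :- D := :- f) refl (divergence Y Z) (value Y)))
            (step-divergence {Z = Z} s g≤g₁ Z≤Y)

  -- If the look-ahead point of Y lies below Z, then divergence Y Z is at most
  -- - 2 value Y, and - value Y was just subtracted by the step from X to Y.
  step-step-divergence : ∀ {h h₁ X Y W Z} → NewtonStep h X Y → NewtonStep h₁ Y W →
                         slope X ≤ slope Y → Negative Y → value Y ≤ value Z → point Z ≤ point Y →
                         point Y - (h₁ + h₁) ≤ point Z →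
                         divergence Y Z + (divergence Y Z + divergence Y Z)
                           ≤ divergence X Z + divergence X Z
  step-step-divergence {h} {h₁} {X} {Y@(tangent δ f g)} {W} {Z@(tangent d φ ψ)} s s₁ g≤g₁ (_ , g<0) f≤φ Z≤Y below =
    ≤-by (0≤+0≤ (0≤+0≤ e₁ e₁) e₂)
      (solve 3 (λ DX DY f → DX :+ DX :- (DY :+ (DY :+ DY))
                            := ((DX :- (DY :- f)) :+ (DX :- (DY :- f))) :+ (:- (f :+ f) :- DY))
         refl (divergence X Z) (divergence Y Z) f)
    where
    e₁ : 0# ≤ divergence X Z - (divergence Y Z - f)
    e₁ = ≤⇒0≤- (step-divergence {Z = Z} s g≤g₁ Z≤Y)

    e₂ : 0# ≤ - (f + f) - divergence Y Z
    e₂ = 0≤-resp-≈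
      (solve 5 (λ φ f g d δ → (φ :- f) :+ ((:- (f :+ f)) :- g :* (d :- δ))
                              := :- (f :+ f) :- (f :+ g :* (d :- δ) :- φ)) refl φ f g d δ)
      (0≤+0≤ (≤⇒0≤- f≤φ) (0≤-resp-≈
        (trans
          (solve 4 (λ h₁ g d δ → (:- g) :* (d :- (δ :- (h₁ :+ h₁)))
                                 := (:- (h₁ :* g :+ h₁ :* g)) :- g :* (d :- δ)) refl h₁ g d δ)
          (+-congʳ (-‿cong (sym (+-cong (NewtonStep.value≈ s₁) (NewtonStep.value≈ s₁))))))
        (0≤*0≤ (neg g<0) (≤⇒0≤- below))))

  -- The slope at `Y` is at most half of that at `X` in absolute value, so twice the rise of the
  -- tangent at `Y` from `Y` to `Z` stays within the rise of the tangent at `X`. The values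
  -- contribute with the right sign, `value Y` being negative and at most `value Z`.
  double-divergence : ∀ {h X Y Z} → 0# < h → DoubleStep h X Y → Negative X → Negative Y →
                      0# ≤ divergence Y X → value Y ≤ value Z → point Z ≤ point Y →
                      divergence Y Z + divergence Y Z ≤ divergence X Z
  double-divergence {h} {X@(tangent δ f g)} {Y@(tangent δ₁ f₁ g₁)} {Z@(tangent d φ ψ)}
                    0<h s (f<0 , _) (f₁<0 , _) p f₁≤φ Z≤Y =
    ≤-by (0≤+0≤ (0≤+0≤ (neg (<-respˡ-≈ (DoubleStep.value≈ s) f<0))
                       (0≤*0≤ halved (≤⇒0≤- Z≤Y)))
                (0≤+0≤ (≤⇒0≤- f₁≤φ) (neg f₁<0)))
      (trans (+-congʳ (divergence-double s Z))
        (solve 7 (λ h g d δ₁ φ f₁ g₁ →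
           (g :* (d :- δ₁) :- h :* g :- φ)
             :- ((f₁ :+ g₁ :* (d :- δ₁) :- φ) :+ (f₁ :+ g₁ :* (d :- δ₁) :- φ))
           := ((:- (h :* g)) :+ (g₁ :+ g₁ :- g) :* (δ₁ :- d)) :+ ((φ :- f₁) :+ (:- f₁)))
           refl h g d δ₁ φ f₁ g₁))
    where
    -- Above `point X` the tangent of `Y` has height value Y + 2 h * slope Y, which must be at least
    -- value X = h * slope X, and `value Y` is negative.
    halved : 0# ≤ g₁ + g₁ - g
    halved = 0≤*⇒0≤ 0<h (0≤-resp-≈
      (trans
        (+-congʳ (+-cong (+-congˡ (*-congˡ (+-congʳ (DoubleStep.point≈ s)))) (-‿cong (DoubleStep.value≈ s))))
        (solve 5 (λ h g δ₁ f₁ g₁ →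
           (f₁ :+ g₁ :* (δ₁ :+ (h :+ h) :- δ₁) :- h :* g) :+ (:- f₁)
           := h :* (g₁ :+ g₁ :- g)) refl h g δ₁ f₁ g₁))
      (0≤+0≤ p (neg f₁<0)))

-- Finite sums and the credits of arcs.

module Counting {c ℓ₁ ℓ₂} (F : OrderedField c ℓ₁ ℓ₂) where
  open OrderedField F hiding (zero)
  open OrderedFieldProperties F
  open IntegerCoefficients commutativeRing
  open Solver using (solve; _:=_; _:+_; _:*_; _:-_; con)
  open CommutativeMonoidSum +-commutativeMonoid using (sum; ∑-distrib-+)
  open SemiringSum semiring using (*-distribʳ-sum)
  open SemiringMultiples semiring using (×-assoc-*; ×-congʳ) renaming (_×_ to _·_)

  +-mono-≤ : ∀ {w x y z} → w ≤ x → y ≤ z → w + y ≤ x + z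
  +-mono-≤ {w} {x} {y} {z} p q = ≤-by (0≤+0≤ (≤⇒0≤- p) (≤⇒0≤- q))
    (solve 4 (λ w x y z → x :+ z :- (w :+ y) := (x :- w) :+ (z :- y)) refl w x y z)

  sum-mono-≤ : ∀ {m} {f g : Vector Carrier m} → (∀ e → f e ≤ g e) → sum f ≤ sum g
  sum-mono-≤ {ℕ.zero}  f≤g = ≤-reflexive refl
  sum-mono-≤ {ℕ.suc m} f≤g = +-mono-≤ (f≤g zero) (sum-mono-≤ (f≤g ∘ suc))

  sum-erase : ∀ {m} (f : Vector Carrier m) e → sum f ≈ f e + sum (updateAt f e (const 0#))
  sum-erase f zero = +-congˡ (sym (+-identityˡ _))
  sum-erase f (suc e) = trans (+-congˡ (sum-erase (f ∘ suc) e))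
    (solve 3 (λ x y z → x :+ (y :+ z) := y :+ (x :+ z)) refl (f zero) (f (suc e)) _)

  sumOver : ∀ {m} → Vector Carrier m → List (Fin m) → Carrier
  sumOver f = foldr (λ e s → f e + s) 0#

  sumOver-cong : ∀ {m} {f g : Vector Carrier m} {P} → All (λ e → f e ≡ g e) P →
                 sumOver f P ≡ sumOver g P
  sumOver-cong []       = ≡.refl
  sumOver-cong (p ∷ ps) = ≡.cong₂ _+_ p (sumOver-cong ps)

  sum-nonneg : ∀ {m} {f : Vector Carrier m} → (∀ e → 0# ≤ f e) → 0# ≤ sum f
  sum-nonneg {ℕ.zero}  0≤f = ≤-reflexive refl
  sum-nonneg {ℕ.suc m} 0≤f = 0≤+0≤ (0≤f zero) (sum-nonneg (0≤f ∘ suc))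

  sumOver≤sum : ∀ {m} {f : Vector Carrier m} {P} → (∀ e → 0# ≤ f e) → Unique P →
                sumOver f P ≤ sum f
  sumOver≤sum 0≤f [] = sum-nonneg 0≤f
  sumOver≤sum {m} {f} {e ∷ P} 0≤f (e∉P ∷ unique) = ≤-trans
    (+-mono-≤ (≤-reflexive refl)
      (≤-trans (≤-reflexive (reflexive (sumOver-cong {f = f} {g = f′} (agree e∉P))))
               (sumOver≤sum 0≤f′ unique)))
    (≤-reflexive (sym (sum-erase f e)))
    where
    f′ = updateAt f e (const 0#)

    agree : ∀ {Q} → All (e ≢_) Q → All (λ d → f d ≡ f′ d) Q
    agree [] = []
    agree (e≢d ∷ ps) = ≡.sym (updateAt-minimal _ e f (e≢d ∘ ≡.sym)) ∷ agree ps

    0≤f′ : ∀ d → 0# ≤ f′ d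
    0≤f′ d with d ≟ e
    ... | yes ≡.refl = ≤-reflexive (reflexive (≡.sym (updateAt-updates e f)))
    ... | no d≢e = ≡.subst (0# ≤_) (≡.sym (updateAt-minimal d e f d≢e)) (0≤f d)

  sum≤card : ∀ {m} {f : Vector Carrier m} {d} (S : Subset m) →
             (∀ {e} → e ∈ S → f e ≤ d) → (∀ {e} → e ∉ S → f e ≤ 0#) →
             sum f ≤ ∣ S ∣ · d
  sum≤card [] _ _ = ≤-reflexive refl
  sum≤card (inside ∷ S) p q = +-mono-≤ (p here) (sum≤card S (p ∘ there) (λ e∉S → q (e∉S ∘ drop-there)))
  sum≤card (outside ∷ S) p q = ≤-trans
    (+-mono-≤ (q (λ ())) (sum≤card S (p ∘ there) (λ e∉S → q (e∉S ∘ drop-there))))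
    (≤-reflexive (+-identityˡ _))

  ·-nonneg : ∀ {d} → 0# < d → ∀ k → 0# ≤ k · d
  ·-nonneg 0<d ℕ.zero    = ≤-reflexive refl
  ·-nonneg 0<d (ℕ.suc k) = 0≤+0≤ (<⇒≤ 0<d) (·-nonneg 0<d k)

  ·-cancel-≤ : ∀ {d} → 0# < d → ∀ k l → k · d ≤ l · d → k ℕ.≤ l
  ·-cancel-≤ 0<d ℕ.zero l p = ℕ.z≤n
  ·-cancel-≤ 0<d (ℕ.suc k) ℕ.zero p = contradiction (0<+0≤ 0<d (·-nonneg 0<d k)) p
  ·-cancel-≤ {d} 0<d (ℕ.suc k) (ℕ.suc l) p = ℕ.s≤s (·-cancel-≤ 0<d k l (≤-by (≤⇒0≤- p)
    (solve 3 (λ d x y → x :- y := d :+ x :- (d :+ y)) refl d _ _)))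

  -- An arc's record is the divergence at its last use, if it is used at all.
  Records : ℕ → Set c
  Records m = Fin m → Maybe Carrier

  recorded : Maybe Carrier → Carrier
  recorded = fromMaybe 0#

  -- If 3 D′ ≤ 2 D, then credit D (just w) / D exceeds credit D′ (just w) / D′ by
  -- at least w / D.
  credit : Carrier → Maybe Carrier → Carrier
  credit D nothing  = 0#
  credit D (just w) = D + (D + D) - (w + w)

  -- Snapshots are visited from the latest to the earliest, so the first record made is that of the
  -- last use and is never overwritten.
  update : ∀ {q} {Q : Set q} → Carrier → Dec Q → Maybe Carrier → Maybe Carrier
  update D _       (just w) = just w
  update D (yes _) nothing  = just D
  update D (no _)  nothing  = nothing

  infix 4 _∈ˡ?_
  _∈ˡ?_ : ∀ {m} (e : Fin m) (P : List (Fin m)) → Dec (e List.∈ P)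
  _∈ˡ?_ = DecMembership._∈?_ _≟_

  record-use : ∀ {m} → Carrier → List (Fin m) → Records m → Records m
  record-use D P A e = update D (e ∈ˡ? P) (A e)

  -- The growth of the credit, multiplied by `D * D′`. A recorded arc leaves the slack w * (2D -
  -- 3D′); a new one gives equality, because its credit 3D - 2D is the recorded value `D` itself.
  update-credit : ∀ {q} {Q : Set q} {D D′} (Q? : Dec Q) a →
    D′ + (D′ + D′) ≤ D + D → 0# ≤ recorded a →
    credit D′ a * D + recorded (update D Q? a) * D′ ≤ credit D (update D Q? a) * D′
  update-credit {D = D} {D′} _ (just w) 3D′≤2D 0≤w = ≤-by (0≤*0≤ 0≤w (≤⇒0≤- 3D′≤2D))
    (solve 3 (λ D D′ w → (D :+ (D :+ D) :- (w :+ w)) :* D′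
                           :- ((D′ :+ (D′ :+ D′) :- (w :+ w)) :* D :+ w :* D′)
                         := w :* (D :+ D :- (D′ :+ (D′ :+ D′)))) refl D D′ w)
  update-credit {D = D} {D′} (yes _) nothing _ _ = ≤-reflexive
    (solve 2 (λ D D′ → con (+ 0) :* D :+ D :* D′ := (D :+ (D :+ D) :- (D :+ D)) :* D′) refl D D′)
  update-credit {D = D} {D′} (no _) nothing _ _ = ≤-reflexive
    (solve 2 (λ D D′ → con (+ 0) :* D :+ con (+ 0) :* D′ := con (+ 0) :* D′) refl D D′)

  update-nonneg : ∀ {q} {Q : Set q} {D} (Q? : Dec Q) a → 0# ≤ D → 0# ≤ recorded a →
                  0# ≤ recorded (update D Q? a)
  update-nonneg _       (just _) _   0≤w = 0≤w
  update-nonneg (yes _) nothing  0≤D _   = 0≤D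
  update-nonneg (no _)  nothing  _   0≤w = 0≤w

  -- In units of the current divergence the total credit grows by at least the recorded values on
  -- `P` divided by `D`, hence by at least 1. The proof multiplies through by `D′` to avoid
  -- division.
  total-credit : ∀ {m D D′ k P} {A : Records m} → 0# < D → 0# < D′ → D′ + (D′ + D′) ≤ D + D →
    (∀ e → 0# ≤ recorded (A e)) → Unique P →
    D ≤ sumOver (λ e → recorded (record-use D P A e)) P →
    k · D′ ≤ sum (λ e → credit D′ (A e)) →
    ℕ.suc k · D ≤ sum (λ e → credit D (record-use D P A e))
  total-credit {m} {D} {D′} {k} {P} {A} 0<D 0<D′ 3D′≤2D 0≤A unique D≤ k≤ =
    0≤-⇒≤ (0≤*⇒0≤ 0<D′ (0≤-resp-≈
      (solve 3 (λ D′ x y → x :* D′ :- y :* D′ := D′ :* (x :- y)) refl D′ _ _)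
      (≤⇒0≤- scaled)))
    where
    B = record-use D P A
    V = λ e → credit D′ (A e)
    V′ = λ e → credit D (B e)
    W = λ e → recorded (B e)

    D≤sumW : D ≤ sum W
    D≤sumW = ≤-trans D≤ (sumOver≤sum {f = W}
      (λ e → update-nonneg (e ∈ˡ? P) (A e) (<⇒≤ 0<D) (0≤A e)) unique)

    swap : (k · D) * D′ ≈ (k · D′) * D
    swap = trans (×-assoc-* k D D′) (trans (×-congʳ k (*-comm D D′)) (sym (×-assoc-* k D′ D)))

    scaled : (ℕ.suc k · D) * D′ ≤ sum V′ * D′
    scaled = ≤-trans
      (≤-by (0≤+0≤ (0≤*0≤ (≤⇒0≤- k≤) (<⇒≤ 0<D)) (0≤*0≤ (≤⇒0≤- D≤sumW) (<⇒≤ 0<D′)))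
        (trans (+-congˡ (-‿cong (trans (distribʳ D′ D (k · D)) (+-congˡ swap))))
          (solve 5 (λ D D′ v w x → v :* D :+ w :* D′ :- (D :* D′ :+ x :* D)
                                   := (v :- x) :* D :+ (w :- D) :* D′)
                   refl D D′ (sum V) (sum W) (k · D′))))
      (≤-trans
        (≤-reflexive (trans (+-cong (*-distribʳ-sum D V) (*-distribʳ-sum D′ W))
                            (sym (∑-distrib-+ (λ e → V e * D) (λ e → W e * D′)))))
        (≤-trans (sum-mono-≤ (λ e → update-credit (e ∈ˡ? P) (A e) 3D′≤2D (0≤A e)))
                 (≤-reflexive (sym (*-distribʳ-sum D′ V′)))))

-- Labels with infinity, and minima of lists of them.

module ExtendedOrder {c ℓ₁ ℓ₂} (F : OrderedField c ℓ₁ ℓ₂) where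
  open OrderedField F hiding (zero)
  open OrderedFieldProperties F
  open M2VPI F using (_⊓_)
  open SupremumNonStrict _≤_ public using (_≤⁺_; [_]; _≤⊤⁺; ≤⁺-trans)
  open SupremumStrict _<_ public using (_<⁺_; [_]; [_]<⊤⁺; <⁺-dec; <⁺-transˡ; <⁺-transʳ; [<]-injective)

  ≤⁺-refl : ∀ {x} → x ≤⁺ x
  ≤⁺-refl {⊤⁺}    = ⊤⁺ ≤⊤⁺
  ≤⁺-refl {[ x ]} = [ ≤-reflexive refl ]

  ≤⁺-reflexive : ∀ {x y} → x ≡ y → x ≤⁺ y
  ≤⁺-reflexive ≡.refl = ≤⁺-refl

  ≤⁺-transitive : ∀ {x y z} → x ≤⁺ y → y ≤⁺ z → x ≤⁺ z
  ≤⁺-transitive = ≤⁺-trans ≤-trans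

  ≤⁺-<⁺-trans : ∀ {x y z} → x ≤⁺ y → y <⁺ z → x <⁺ z
  ≤⁺-<⁺-trans = <⁺-transʳ ≤-<-trans

  <⁺-≤⁺-trans : ∀ {x y z} → x <⁺ y → y ≤⁺ z → x <⁺ z
  <⁺-≤⁺-trans = <⁺-transˡ <-≤-trans

  <⁺-irrefl : ∀ {x} → ¬ (x <⁺ x)
  <⁺-irrefl [ x<x ] = <-irrefl refl x<x

  ≮⁺⇒≥⁺ : ∀ {x y} → ¬ (x <⁺ y) → y ≤⁺ x
  ≮⁺⇒≥⁺ {⊤⁺}    {y}     _   = y ≤⊤⁺
  ≮⁺⇒≥⁺ {[ x ]} {⊤⁺}    x≮y = contradiction [ x ]<⊤⁺ x≮y
  ≮⁺⇒≥⁺ {[ x ]} {[ y ]} x≮y = [ x≮y ∘ [_] ]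

  ≤⁺⇒≯⁺ : ∀ {x y} → x ≤⁺ y → ¬ (y <⁺ x)
  ≤⁺⇒≯⁺ x≤y y<x = <⁺-irrefl (≤⁺-<⁺-trans x≤y y<x)

  <⁺⇒≤⁺ : ∀ {x y} → x <⁺ y → x ≤⁺ y
  <⁺⇒≤⁺ [ p ]      = [ <⇒≤ p ]
  <⁺⇒≤⁺ [ x ]<⊤⁺ = [ x ] ≤⊤⁺

  Finite : Carrier ⁺ → Set c
  Finite x = ∃[ t ] x ≡ [ t ]

  ≤⁺-finite : ∀ {x y} → x ≤⁺ y → Finite y → Finite x
  ≤⁺-finite [ _ ] _ = _ , ≡.refl

  <⁺-finite : ∀ {x y} → x <⁺ y → Finite x
  <⁺-finite [ _ ]      = _ , ≡.refl
  <⁺-finite [ x ]<⊤⁺ = x , ≡.refl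

  [≤]-injective : ∀ {x y} → [ x ] ≤⁺ [ y ] → x ≤ y
  [≤]-injective [ p ] = p

  ≤⁺-top : ∀ {x} → ⊤⁺ ≤⁺ x → x ≡ ⊤⁺
  ≤⁺-top (⊤⁺ ≤⊤⁺) = ≡.refl

  -- The junk value at +∞ is 0#.
  finitePart : Carrier ⁺ → Carrier
  finitePart = fromMaybe 0#

  finitePart-finite : ∀ {x} → Finite x → x ≡ [ finitePart x ]
  finitePart-finite (_ , ≡.refl) = ≡.refl

  finitePart-mono : ∀ {x y} → x ≤⁺ y → Finite y → finitePart x ≤ finitePart y
  finitePart-mono [ p ] _ = p

  ⊓-≤ˡ : ∀ x y → x ⊓ y ≤⁺ x
  ⊓-≤ˡ x y with <⁺-dec _<?_ x y
  ... | yes _   = ≤⁺-refl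
  ... | no  x≮y = ≮⁺⇒≥⁺ x≮y

  ⊓-≤ʳ : ∀ x y → x ⊓ y ≤⁺ y
  ⊓-≤ʳ x y with <⁺-dec _<?_ x y
  ... | yes x<y = <⁺⇒≤⁺ x<y
  ... | no  _   = ≤⁺-refl

  ⊓-sel : ∀ x y → x ⊓ y ≡ x ⊎ x ⊓ y ≡ y
  ⊓-sel x y with <⁺-dec _<?_ x y
  ... | yes _ = inj₁ ≡.refl
  ... | no  _ = inj₂ ≡.refl

  module _ {a} {A : Set a} (f : A → Carrier ⁺) where
    minimum : List A → Carrier ⁺
    minimum xs = foldr _⊓_ ⊤⁺ (map f xs)

    minimum-≤ : ∀ {x xs} → x List.∈ xs → minimum xs ≤⁺ f x
    minimum-≤ {x} (here ≡.refl) = ⊓-≤ˡ (f x) _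
    minimum-≤ {xs = y ∷ _} (there x∈xs) = ≤⁺-transitive (⊓-≤ʳ (f y) _) (minimum-≤ x∈xs)

    minimum-attained : ∀ xs → minimum xs ≡ ⊤⁺ ⊎ ∃[ x ] (x List.∈ xs × minimum xs ≡ f x)
    minimum-attained [] = inj₁ ≡.refl
    minimum-attained (x ∷ xs) with ⊓-sel (f x) (minimum xs) | minimum-attained xs
    ... | inj₁ eq | _                     = inj₂ (x , here ≡.refl , eq)
    ... | inj₂ eq | inj₁ eq′              = inj₁ (≡.trans eq eq′)
    ... | inj₂ eq | inj₂ (w , w∈xs , eq′) = inj₂ (w , there w∈xs , ≡.trans eq eq′)

-- Grapevine: monotonicity, feasibility and the traced walk.

module Grapevine {c ℓ₁ ℓ₂} (F : OrderedField c ℓ₁ ℓ₂)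
                 {n m : ℕ} (G : M2VPI.System F n m) (S : Subset m) where
  open OrderedField F hiding (zero)
  open OrderedFieldProperties F
  open IntegerCoefficients commutativeRing
  open Solver using (solve; _:=_; _:+_; _:*_; _:-_; con)
  open ExtendedOrder F
  open M2VPI F
  open System G
  open Subgraph G S

  Feasible : Labels n → Set (c ⊔ ℓ₂)
  Feasible z = ∀ {e} → e ∈ S → z (tail e) ≤⁺ arcValue z e

  ¬violated⇒feasible : ∀ {z} → ¬ HasViolatedArc z → Feasible z
  ¬violated⇒feasible ¬violated e∈S = ≮⁺⇒≥⁺ (λ p → ¬violated (_ , e∈S , p))

  violated? : ∀ z → Dec (HasViolatedArc z)
  violated? z = any? (λ e → (e ∈? S) ×-dec <⁺-dec _<?_ (arcValue z e) (z (tail e)))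

  arcValue-mono : ∀ y z e → y (head e) ≤⁺ z (head e) → arcValue y e ≤⁺ arcValue z e
  arcValue-mono y z e p with y (head e) | z (head e)
  arcValue-mono y z e [ p ]     | [ s ] | [ t ] = [ ≤-by (0≤*0≤ (<⇒≤ (gain-pos e)) (≤⇒0≤- p))
    (solve 4 (λ a g s t → a :+ g :* t :- (a :+ g :* s) := g :* (t :- s)) refl (cost e) (gain e) s t) ]
  arcValue-mono y z e (_ ≤⊤⁺)   | _     | ⊤⁺    = _ ≤⊤⁺

  arcValue-cancel : ∀ y z e → arcValue y e ≤⁺ arcValue z e → y (head e) ≤⁺ z (head e)
  arcValue-cancel y z e p with y (head e) | z (head e)
  arcValue-cancel y z e p         | _     | ⊤⁺    = _ ≤⊤⁺
  arcValue-cancel y z e [ p ]     | [ s ] | [ t ] = [ 0≤-⇒≤ (0≤*⇒0≤ (gain-pos e) (0≤-resp-≈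
    (solve 4 (λ a g s t → a :+ g :* t :- (a :+ g :* s) := g :* (t :- s)) refl (cost e) (gain e) s t)
    (≤⇒0≤- p))) ]

  arcValue-finite : ∀ z e → Finite (z (head e)) → Finite (arcValue z e)
  arcValue-finite z e (t , eq) = _ , ≡.cong (Maybe.map _) eq

  finite-head : ∀ z e → Finite (arcValue z e) → Finite (z (head e))
  finite-head z e p with z (head e)
  finite-head z e _        | [ t ] = t , ≡.refl
  finite-head z e (_ , ()) | ⊤⁺

  finitePart-feasible : ∀ {z} → Feasible z → ∀ {e} → e ∈ S → Finite (z (head e)) →
    finitePart (z (tail e)) ≤ cost e + gain e * finitePart (z (head e))
  finitePart-feasible {z} feasible {e} e∈S fin = ≤-trans
    (finitePart-mono (feasible e∈S) (arcValue-finite z e fin))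
    (≤-reflexive (reflexive (≡.cong finitePart
      (≡.cong (Maybe.map _) (finitePart-finite fin)))))

  bestOut-≤ : ∀ y {v} e → e ∈ S → tail e ≡ v → bestOut y v ≤⁺ arcValue y e
  bestOut-≤ y e e∈S eq = minimum-≤ (arcValue y) (∈-filter⁺ _ (∈-allFin e) (e∈S , eq))

  bestOut-attained : ∀ y v → bestOut y v ≡ ⊤⁺ ⊎
                     ∃[ e ] (e ∈ S × tail e ≡ v × bestOut y v ≡ arcValue y e)
  bestOut-attained y v with minimum-attained (arcValue y) (outArcs v)
  ... | inj₁ eq = inj₁ eq
  ... | inj₂ (e , e∈ , eq) with ∈-filter⁻ (λ e → (e ∈? S) ×-dec (tail e ≟ v)) {xs = allFin m} e∈
  ...   | _ , e∈S , te = inj₂ (e , e∈S , te , eq)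

  round-≤ : ∀ y v → round y v ≤⁺ y v
  round-≤ y v = ⊓-≤ˡ _ _

  round-≤-arc : ∀ y {v} e → e ∈ S → tail e ≡ v → round y v ≤⁺ arcValue y e
  round-≤-arc y {v} e e∈S eq = ≤⁺-transitive (⊓-≤ʳ (y v) _) (bestOut-≤ y e e∈S eq)

  round-cases : ∀ y v → round y v ≡ y v ⊎
                ∃[ e ] (e ∈ S × tail e ≡ v × round y v ≡ arcValue y e)
  round-cases y v with ⊓-sel (y v) (bestOut y v) | bestOut-attained y v
  ... | inj₁ eq | _ = inj₁ eq
  ... | inj₂ eq | inj₂ (e , e∈S , te , eq′) = inj₂ (e , e∈S , te , ≡.trans eq eq′)
  ... | inj₂ eq | inj₁ eq′ = inj₁ (≡.trans top (≡.sym (≤⁺-top (≡.subst (_≤⁺ y v) top (round-≤ y v)))))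
    where top = ≡.trans eq eq′

  round-improved : ∀ y {v} → round y v <⁺ y v →
                   ∃[ e ] (e ∈ S × tail e ≡ v × round y v ≡ arcValue y e)
  round-improved y {v} lt with round-cases y v
  ... | inj₁ eq = contradiction (≡.subst (_<⁺ y v) eq lt) <⁺-irrefl
  ... | inj₂ p  = p

  grapevine-≤ : ∀ {i j} y v → i ℕ.≤ j → grapevine j y v ≤⁺ grapevine i y v
  grapevine-≤ y v i≤j = go (ℕ.≤⇒≤′ i≤j)
    where
    go : ∀ {i j} → i ℕ.≤′ j → grapevine j y v ≤⁺ grapevine i y v
    go ℕ.≤′-refl                 = ≤⁺-refl
    go (ℕ.≤′-step {n = j} i≤j) = ≤⁺-transitive (round-≤ (grapevine j y) v) (go i≤j)

  grapevine-≥ : ∀ {y z} → Feasible z → (∀ v → z v ≤⁺ y v) → ∀ r v → z v ≤⁺ grapevine r y v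
  grapevine-≥ feasible z≤y ℕ.zero v = z≤y v
  grapevine-≥ {y} {z} feasible z≤y (ℕ.suc r) v with round-cases (grapevine r y) v
  ... | inj₁ eq = ≡.subst (z v ≤⁺_) (≡.sym eq) (grapevine-≥ {y} {z} feasible z≤y r v)
  ... | inj₂ (e , e∈S , ≡.refl , eq) = ≡.subst (z v ≤⁺_) (≡.sym eq)
    (≤⁺-transitive (feasible e∈S)
      (arcValue-mono z (grapevine r y) e (grapevine-≥ {y} {z} feasible z≤y r (head e))))

  -- Finiteness spreads only from heads to tails, and the finite part of a feasible `z` is closed
  -- under this spread.
  grapevine-finite : ∀ {y z} → Feasible z → (∀ v → Finite (y v) → Finite (z v)) →
                     ∀ r v → Finite (grapevine r y v) → Finite (z v)
  grapevine-finite feasible fin ℕ.zero v p = fin v p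
  grapevine-finite {y} {z} feasible fin (ℕ.suc r) v p with round-cases (grapevine r y) v
  ... | inj₁ eq = grapevine-finite {y} {z} feasible fin r v (≡.subst Finite eq p)
  ... | inj₂ (e , e∈S , ≡.refl , eq) = ≤⁺-finite (feasible e∈S) (arcValue-finite z e
    (grapevine-finite {y} {z} feasible fin r (head e)
      (finite-head (grapevine r y) e (≡.subst Finite eq p))))

  grapevine-sink : ∀ {v} → (∀ e → tail e ≢ v) → ∀ y r → grapevine r y v ≡ y v
  grapevine-sink isSink y ℕ.zero = ≡.refl
  grapevine-sink {v} isSink y (ℕ.suc r) with round-cases (grapevine r y) v
  ... | inj₁ eq = ≡.trans eq (grapevine-sink isSink y r)
  ... | inj₂ (e , _ , te , _) = contradiction te (isSink e)

  pred-exists : ∀ y v → ∃ (IsPred y v)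
  pred-exists y v with <⁺-dec _<?_ (round y v) (y v)
  ... | no  ≮ = nothing , same ≮
  ... | yes lt with round-improved y lt
  ...   | e , e∈S , te , eq = just e , improved lt (e∈S , te , λ e′ e′∈S te′ →
          ≤⁺⇒≯⁺ (≡.subst (_≤⁺ arcValue y e′) eq (round-≤-arc y e′ e′∈S te′)))

  walk-exists : ∀ r y s → ∃ (IsGrapevineWalk r y s)
  walk-exists r y s = _ , (λ i v → proj₁ (pred-exists (grapevine i y) v)) ,
    (λ i v _ → proj₂ (pred-exists (grapevine i y) v)) , ≡.refl

  minimizing-≤ : ∀ y {v e} → round y v <⁺ y v → IsMinimizingArc y v e → arcValue y e ≤⁺ round y v
  minimizing-≤ y {v} {e} lt (_ , _ , minimal) with round-improved y lt
  ... | e′ , e′∈S , te′ , eq = ≡.subst (arcValue y e ≤⁺_) (≡.sym eq) (≮⁺⇒≥⁺ (minimal e′ e′∈S te′))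

  -- Feasibility supplies the opposite inequality. Finiteness is included so that tightness turns
  -- into an equation between field elements.
  Tight : Labels n → Fin m → Set (c ⊔ ℓ₂)
  Tight z e = Finite (z (tail e)) × arcValue z e ≤⁺ z (tail e)

  -- `z` are the final labels, `y` the initial ones, `yᵢ` those after the rounds still to be traced.
  -- `settled` is what makes the arcs distinct in the induction: the tails further along the trace
  -- already have their final labels, while the tail just recorded still drops.
  record TraceProperties (z y yᵢ : Labels n) (v : Fin n) (P : List (Fin m)) : Set (c ⊔ ℓ₂) where
    field
      walk     : IsWalk v P (endpoint v P)
      tight    : All (Tight z) P
      settled  : All (λ e → yᵢ (tail e) ≤⁺ z (tail e)) P
      unique   : Unique P
      end      : y (endpoint v P) ≤⁺ z (endpoint v P)
      progress : P ≡ [] ⊎ z v <⁺ y v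

  -- A label that is read by the trace is already final: otherwise its later
  -- decrease would propagate along the trace to the start.
  trace-properties : ∀ {y r pred} → Feasible (grapevine r y) →
    (∀ i v → i ℕ.< r → IsPred (grapevine i y) v (pred i v)) →
    ∀ i v → i ℕ.≤ r → grapevine i y v ≤⁺ grapevine r y v →
    TraceProperties (grapevine r y) y (grapevine i y) v (trace pred i v)
  trace-properties feasible isPred ℕ.zero v _ final = record
    { walk = ≡.refl ; tight = [] ; settled = [] ; unique = [] ; end = final ; progress = inj₁ ≡.refl }
  trace-properties {y} {r} {pred} feasible isPred (ℕ.suc i) v i<r final with pred i v | isPred i v i<r
  ... | nothing | same ≮ = record
    { walk = T.walk ; tight = T.tight ; unique = T.unique ; end = T.end ; progress = T.progress
    ; settled = All.map (≤⁺-transitive (round-≤ (grapevine i y) _)) T.settled }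
    where
    module T = TraceProperties (trace-properties {y} {r} {pred} feasible isPred i v (ℕ.<⇒≤ i<r)
                 (≤⁺-transitive (≮⁺⇒≥⁺ ≮) final))
  ... | just e | improved lt min@(e∈S , ≡.refl , _) = record
    { walk     = e∈S , ≡.refl , T.walk
    ; tight    = (≤⁺-finite z≤y (<⁺-finite lt) ,
                  ≤⁺-transitive (arcValue-mono z (grapevine i y) e z≤yᵢ) yᵢe≤z) ∷ T.tight
    ; settled  = final ∷ All.map (≤⁺-transitive (round-≤ (grapevine i y) _)) T.settled
    -- If `e` came again later on the trace, its tail would be settled after `i` rounds, yet the
    -- next round still lowers it.
    ; unique   = All.map (λ { settled ≡.refl → ≤⁺⇒≯⁺ settled (≤⁺-<⁺-trans z≤y lt) }) T.settled ∷ T.unique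
    ; end      = T.end
    ; progress = inj₂ (≤⁺-<⁺-trans z≤y (<⁺-≤⁺-trans lt (grapevine-≤ {j = i} y _ ℕ.z≤n)))
    }
    where
    z = grapevine r y
    z≤y : z (tail e) ≤⁺ grapevine (ℕ.suc i) y (tail e)
    z≤y = grapevine-≤ y _ i<r
    z≤yᵢ : z (head e) ≤⁺ grapevine i y (head e)
    z≤yᵢ = grapevine-≤ y _ (ℕ.<⇒≤ i<r)
    yᵢe≤z : arcValue (grapevine i y) e ≤⁺ z (tail e)
    yᵢe≤z = ≤⁺-transitive (minimizing-≤ (grapevine i y) lt min) final
    module T = TraceProperties (trace-properties {y} {r} {pred} feasible isPred i (head e) (ℕ.<⇒≤ i<r)
                 (arcValue-cancel (grapevine i y) z e (≤⁺-transitive yᵢe≤z (feasible e∈S))))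

  walk-properties : ∀ {y r s P} → Feasible (grapevine r y) → IsGrapevineWalk r y s P →
                    TraceProperties (grapevine r y) y (grapevine r y) s P
  walk-properties {y} {r} {s} feasible (pred , isPred , ≡.refl) =
    trace-properties {y} {r} {pred} feasible isPred r s ℕ.≤-refl ≤⁺-refl

  -- If the walk stopped before the sink, it would not improve on labels that
  -- are feasible along it.
  walk-ends-at-sink : ∀ {o} y z {v} P → (∀ e → tail e ≢ o) →
    (∀ {e} → e ∈ S → head e ≢ o → y (tail e) ≤⁺ arcValue y e) →
    All (Tight z) P → IsWalk v P (endpoint v P) → y (endpoint v P) ≤⁺ z (endpoint v P) →
    endpoint v P ≡ o ⊎ y v ≤⁺ z v
  walk-ends-at-sink y z [] _ _ _ _ end = inj₂ end
  walk-ends-at-sink {o} y z (e ∷ P) isSink feasible (t ∷ ts) (e∈S , ≡.refl , walk) end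
    with walk-ends-at-sink y z P isSink feasible ts walk end | head e ≟ o
  ... | inj₁ eq | _ = inj₁ eq
  ... | inj₂ le | no h≢o = inj₂ (≤⁺-transitive (feasible e∈S h≢o)
                             (≤⁺-transitive (arcValue-mono y z e le) (proj₂ t)))
  walk-ends-at-sink y z (e ∷ []) isSink feasible _ _ _ | inj₂ _ | yes h≡o = inj₁ h≡o
  walk-ends-at-sink y z (e ∷ e′ ∷ P) isSink feasible _ (_ , _ , _ , te′ , _) _ | inj₂ _ | yes h≡o =
    contradiction (≡.trans te′ h≡o) (isSink e′)

-- Settling within n rounds between two feasible labellings.

module Stabilisation {c ℓ₁ ℓ₂} (F : OrderedField c ℓ₁ ℓ₂)
                     {n m : ℕ} (G : M2VPI.System F (ℕ.suc n) m) (S : Subset m)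
                     (isSink : ∀ e → zero ≢ M2VPI.System.tail G e) where
  open OrderedField F hiding (zero)
  open OrderedFieldProperties F
  open IntegerCoefficients commutativeRing
  open Solver using (solve; _:=_; _:+_; _:*_; _:-_; con)
  open ExtendedOrder F
  open M2VPI F
  open System G
  open Subgraph G S
  open Grapevine F G S

  module _ {low y high : Labels (ℕ.suc n)}
           (low-feasible : Feasible low) (high-feasible : Feasible high)
           (low≤y : ∀ v → low v ≤⁺ y v) (y≤high : ∀ v → y v ≤⁺ high v)
           (finite-high : ∀ v → Finite (y v) → Finite (high v)) where

    Improves : ℕ → Fin (ℕ.suc n) → Set (c ⊔ ℓ₂)
    Improves j v = grapevine (ℕ.suc j) y v <⁺ grapevine j y v

    -- `Improves j v` says that round j + 1 lowers `v`. The chain runs back to round 1, each drop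
    -- being caused by a drop of the head one round earlier. In `first` the arc serves to show that
    -- `v` is not the sink.
    data Descent : ℕ → Fin (ℕ.suc n) → Set (c ⊔ ℓ₂) where
      first : ∀ {v e} → tail e ≡ v → Improves 0 v → Descent 0 v
      next  : ∀ {j v e} → e ∈ S → tail e ≡ v → Improves (ℕ.suc j) v →
              grapevine (ℕ.suc (ℕ.suc j)) y v ≡ arcValue (grapevine (ℕ.suc j) y) e →
              Descent j (head e) → Descent (ℕ.suc j) v

    improves : ∀ {j v} → Descent j v → Improves j v
    improves (first _ p)      = p
    improves (next _ _ p _ _) = p

    node≢zero : ∀ {j v} → Descent j v → zero ≢ v
    node≢zero (first {e = e} te _)      eq = isSink e (≡.trans eq (≡.sym te))
    node≢zero (next {e = e} _ te _ _ _) eq = isSink e (≡.trans eq (≡.sym te))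

    -- If the head had not dropped in the round before, the same arc would already have offered the
    -- tail this value one round earlier.
    descent : ∀ j v → Improves j v → Descent j v
    descent ℕ.zero v p with round-improved y p
    ... | e , _ , te , _ = first te p
    descent (ℕ.suc j) v p with round-improved (grapevine (ℕ.suc j) y) p
    ... | e , e∈S , ≡.refl , eq = next e∈S ≡.refl p eq (descent j (head e) head-improves)
      where
      head-improves : Improves j (head e)
      head-improves with <⁺-dec _<?_ (grapevine (ℕ.suc j) y (head e)) (grapevine j y (head e))
      ... | yes lt = lt
      ... | no ≮ = contradiction p (≤⁺⇒≯⁺ (≤⁺-transitive
        (round-≤-arc (grapevine j y) e e∈S ≡.refl)
        (≡.subst (arcValue (grapevine j y) e ≤⁺_) (≡.sym eq)
          (arcValue-mono (grapevine j y) (grapevine (ℕ.suc j) y) e (≮⁺⇒≥⁺ ≮)))))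

    node : ∀ {j v} → Descent j v → Fin (ℕ.suc j) → Fin (ℕ.suc n)
    node {v = v} d             zero    = v
    node (next _ _ _ _ d) (suc i) = node d i

    node-nonzero : ∀ {j v} (d : Descent j v) i → zero ≢ node d i
    node-nonzero d@(first _ _)    zero    = node≢zero d
    node-nonzero d@(next _ _ _ _ _) zero    = node≢zero d
    node-nonzero (next _ _ _ _ d) (suc i) = node-nonzero d i

    label : ℕ → Fin (ℕ.suc n) → Carrier
    label j v = finitePart (grapevine j y v)

    -- A walk from v to w along the descent acts on labels as t ↦ a + b * t.
    record Segment (j : ℕ) (v w : Fin (ℕ.suc n)) : Set (c ⊔ ℓ₁ ⊔ ℓ₂) where
      field
        time    : ℕ
        time≤   : time ℕ.≤ j
        drop    : Improves time w
        a b     : Carrier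
        0≤b     : 0# ≤ b
        exact   : label (ℕ.suc j) v ≈ a + b * label (ℕ.suc time) w
        low≤    : finitePart (low v) ≤ a + b * finitePart (low w)
        high≤   : finitePart (high v) ≤ a + b * finitePart (high w)

    module _ j v (d : Improves j v) where
      finite-label : Finite (grapevine (ℕ.suc j) y v)
      finite-label = <⁺-finite d

      finite-low : Finite (low v)
      finite-low = ≤⁺-finite (grapevine-≥ {y} {low} low-feasible low≤y (ℕ.suc j) v) finite-label

      finite-high′ : Finite (high v)
      finite-high′ = grapevine-finite {y} {high} high-feasible finite-high (ℕ.suc j) v finite-label

    segment : ∀ {j v} (d : Descent j v) i → Segment j v (node d i)
    segment {j} d zero = record
      { time = j ; time≤ = ℕ.≤-refl ; drop = improves d ; a = 0# ; b = 1# ; 0≤b = <⇒≤ 0<1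
      ; exact = identity _ ; low≤ = ≤-reflexive (identity _) ; high≤ = ≤-reflexive (identity _) }
      where
      identity : ∀ t → t ≈ 0# + 1# * t
      identity t = solve 1 (λ t → t := con (+ 0) :+ con (+ 1) :* t) refl t
    segment {ℕ.suc j} (next {e = e} e∈S ≡.refl p eq d) (suc i) = record
      { time  = S′.time ; time≤ = ℕ.m≤n⇒m≤1+n S′.time≤ ; drop = S′.drop
      ; a     = cost e + gain e * S′.a
      ; b     = gain e * S′.b
      ; 0≤b   = 0≤*0≤ (<⇒≤ (gain-pos e)) S′.0≤b
      ; exact = trans (reflexive (≡.cong finitePart eq))
                  (trans (reflexive (≡.cong finitePart (≡.cong (Maybe.map _) (finitePart-finite (finite-label j (head e) (improves d))))))
                    (trans (+-congˡ (*-congˡ S′.exact)) (compose _)))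
      ; low≤  = via {low} low-feasible (finite-low j (head e) (improves d)) S′.low≤
      ; high≤ = via {high} high-feasible (finite-high′ j (head e) (improves d)) S′.high≤
      }
      where
      module S′ = Segment (segment d i)
      compose : ∀ t → cost e + gain e * (S′.a + S′.b * t) ≈ (cost e + gain e * S′.a) + (gain e * S′.b) * t
      compose t = solve 5 (λ k g a b t → k :+ g :* (a :+ b :* t) := (k :+ g :* a) :+ (g :* b) :* t)
                    refl (cost e) (gain e) S′.a S′.b t
      via : ∀ {z} → Feasible z → Finite (z (head e)) →
            finitePart (z (head e)) ≤ S′.a + S′.b * finitePart (z (node d i)) →
            finitePart (z (tail e)) ≤ (cost e + gain e * S′.a) + (gain e * S′.b) * finitePart (z (node d i))
      via {z} feasible fin p = ≤-trans (finitePart-feasible {z} feasible e∈S fin)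
        (≤-trans (≤-by (0≤*0≤ (<⇒≤ (gain-pos e)) (≤⇒0≤- p))
                   (solve 4 (λ k g x y → k :+ g :* y :- (k :+ g :* x) := g :* (y :- x))
                     refl (cost e) (gain e) _ _))
                 (≤-reflexive (compose _)))

    -- The affine map of the cycle lies above the identity at low and high,
    -- hence also at the label in between, which contradicts its decrease.
    no-cycle : ∀ j v → Improves (ℕ.suc j) v → (s : Segment (ℕ.suc j) v v) →
               ¬ (Segment.time s ℕ.≤ j)
    no-cycle j v decrease s time≤j = ≤-trans t≤a+bt (≤-reflexive (sym exact)) t′<t
      where
      open Segment s
      t = label (ℕ.suc time) v

      finite-t : Finite (grapevine (ℕ.suc time) y v)
      finite-t = finite-label time v drop

      t′<t : label (ℕ.suc (ℕ.suc j)) v < t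
      t′<t = [<]-injective (≡.subst₂ _<⁺_ (finitePart-finite (finite-label (ℕ.suc j) v decrease)) (finitePart-finite finite-t)
        (<⁺-≤⁺-trans decrease (grapevine-≤ {ℕ.suc time} {ℕ.suc j} y v (ℕ.s≤s time≤j))))

      low≤t : finitePart (low v) ≤ t
      low≤t = finitePart-mono (grapevine-≥ {y} {low} low-feasible low≤y (ℕ.suc time) v) finite-t

      t≤high : t ≤ finitePart (high v)
      t≤high = finitePart-mono (≤⁺-transitive (grapevine-≤ {0} {ℕ.suc time} y v ℕ.z≤n) (y≤high v)) (finite-high′ (ℕ.suc j) v decrease)

      t≤a+bt : t ≤ a + b * t
      t≤a+bt with b <? 1#
      ... | yes b<1 = ≤-by (0≤+0≤ (≤⇒0≤- high≤) (0≤*0≤ (≤⇒0≤- (<⇒≤ b<1)) (≤⇒0≤- t≤high)))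
        (solve 4 (λ a b t h → a :+ b :* t :- t := (a :+ b :* h :- h) :+ (con (+ 1) :- b) :* (h :- t))
          refl a b t _)
      ... | no 1≤b = ≤-by (0≤+0≤ (≤⇒0≤- low≤) (0≤*0≤ (≤⇒0≤- 1≤b) (≤⇒0≤- low≤t)))
        (solve 4 (λ a b t l → a :+ b :* t :- t := (a :+ b :* l :- l) :+ (b :- con (+ 1)) :* (t :- l))
          refl a b t _)

    node-injective : ∀ {j v} (d : Descent j v) {i k} → i Fin.< k → node d i ≢ node d k
    node-injective {ℕ.suc j} d@(next _ ≡.refl p _ d′) {zero} {suc k} _ eq =
      no-cycle j _ p (≡.subst (Segment _ _) (≡.sym eq) (segment d (suc k))) (bound (≡.sym eq))
      where
      bound : ∀ {w} (eq : node d′ k ≡ w) →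
              Segment.time (≡.subst (Segment _ _) eq (segment d (suc k))) ℕ.≤ j
      bound ≡.refl = Segment.time≤ (segment d′ k)
    node-injective (next _ _ _ _ d) {suc i} {suc k} (ℕ.s≤s i<k) eq = node-injective d i<k eq

    -- An improvement in round n + 1 traces back through n + 1 nodes, none of them the sink. Only n
    -- other nodes exist, so two coincide, against `no-cycle`.
    stabilises : ¬ HasViolatedArc (grapevine n y)
    stabilises (e , e∈S , violated)
      with d ← descent n (tail e) (≤⁺-<⁺-trans (round-≤-arc (grapevine n y) e e∈S ≡.refl) violated)
      with i , k , i<k , eq ← pigeonhole (ℕ.n<1+n n) (λ i → punchOut (node-nonzero d i))
      = node-injective d i<k (punchOut-injective (node-nonzero d i) (node-nonzero d k) eq)

-- Snapshots, their walks and the charging argument.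

module Snapshots {c ℓ₁ ℓ₂} (F : OrderedField c ℓ₁ ℓ₂)
                 {n m : ℕ} (G : M2VPI.System F n m) (S : Subset m) (source sink : Fin n) where
  open OrderedField F hiding (zero)
  open OrderedFieldProperties F
  open IntegerCoefficients commutativeRing
  open Solver using (solve; _:=_; _:+_; _:*_; _:-_; con)
  open ExtendedOrder F
  open Tangents F
  open Counting F
  open CommutativeMonoidSum +-commutativeMonoid using (sum; sum-replicate-zero)
  open SemiringMultiples semiring using (×-congʳ; ×-assocˡ) renaming (_×_ to _·_)
  open RingProperties ring using (-0#≈0#)
  open M2VPI F
  open System G
  open Subgraph G S
  open Grapevine F G S

  reducedCost : (Fin n → Carrier) → Fin m → Carrier
  reducedCost p e = cost e + gain e * p (head e) - p (tail e)

  -- Horner form of the sum of `r e`, each weighted by the gain of the part of the walk before `e`.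
  walkSum : (Fin m → Carrier) → List (Fin m) → Carrier
  walkSum r []       = 0#
  walkSum r (e ∷ es) = r e + gain e * walkSum r es

  -- In the difference the costs cancel, and the head term of each arc cancels against the tail term
  -- of the next, so only the two ends remain.
  walkSum-telescopes : ∀ p q {v w} P → IsWalk v P w →
    walkSum (reducedCost p) P - walkSum (reducedCost q) P ≈ walkGain P * (p w - q w) - (p v - q v)
  walkSum-telescopes p q {v} [] ≡.refl =
    solve 2 (λ x y → con (+ 0) :- con (+ 0) := con (+ 1) :* (x :- y) :- (x :- y)) refl (p v) (q v)
  walkSum-telescopes p q {w = w} (e ∷ P) (_ , ≡.refl , walk) = trans
    (solve 8 (λ k g x y x′ y′ s t →
       (k :+ g :* x :- x′ :+ g :* s) :- (k :+ g :* y :- y′ :+ g :* t)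
       := g :* (x :- y) :- (x′ :- y′) :+ g :* (s :- t)) refl
       (cost e) (gain e) (p (head e)) (q (head e)) (p (tail e)) (q (tail e))
       (walkSum (reducedCost p) P) (walkSum (reducedCost q) P))
    (trans (+-congˡ (*-congˡ (walkSum-telescopes p q P walk)))
      (solve 5 (λ g x d z t → g :* x :- d :+ g :* (z :* t :- x) := (g :* z) :* t :- d) refl
        (gain e) (p (head e) - q (head e)) (p (tail e) - q (tail e)) (walkGain P) (p w - q w)))

  walkSum-zero : ∀ {r P} → All (λ e → r e ≈ 0#) P → walkSum r P ≈ 0#
  walkSum-zero [] = refl
  walkSum-zero (r≈0 ∷ rs) = trans (+-cong r≈0 (trans (*-congˡ (walkSum-zero rs)) (zeroʳ _))) (+-identityˡ 0#)

  walkSum-nonneg : ∀ {r P} → All (λ e → 0# ≤ r e) P → 0# ≤ walkSum r P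
  walkSum-nonneg []       = ≤-reflexive refl
  walkSum-nonneg (p ∷ ps) = 0≤+0≤ p (0≤*0≤ (<⇒≤ (gain-pos _)) (walkSum-nonneg ps))

  walkGain-pos : ∀ P → 0# < walkGain P
  walkGain-pos []      = 0<1
  walkGain-pos (e ∷ P) = *-pos (gain-pos e) (walkGain-pos P)

  walkSum-term : ∀ {r e} Q {R} → All (λ e → 0# ≤ r e) (Q ++ e ∷ R) →
                 walkGain Q * r e ≤ walkSum r (Q ++ e ∷ R)
  walkSum-term {r} {e} [] {R} (_ ∷ ps) = ≤-by (0≤*0≤ (<⇒≤ (gain-pos e)) (walkSum-nonneg ps))
    (solve 2 (λ x y → x :+ y :- con (+ 1) :* x := y) refl (r e) (gain e * walkSum r R))
  walkSum-term {r} {e} (d ∷ Q) {R} (p ∷ ps) = ≤-by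
    (0≤+0≤ p (0≤*0≤ (<⇒≤ (gain-pos d)) (≤⇒0≤- (walkSum-term Q ps))))
    (solve 5 (λ x g s k y → x :+ g :* s :- (g :* k) :* y := x :+ g :* (s :- k :* y)) refl
      (r d) (gain d) (walkSum r (Q ++ e ∷ R)) (walkGain Q) (r e))

  walkSum-≤-sumOver : ∀ {r f} P → (∀ Q e R → P ≡ Q ++ e ∷ R → walkGain Q * r e ≤ f e) →
                      walkSum r P ≤ sumOver f P
  walkSum-≤-sumOver {r} {f} P bound = ≤-trans (≤-reflexive (sym (*-identityˡ _)))
    (go 1# P (λ Q e R eq → ≤-trans (≤-reflexive (*-congʳ (*-identityˡ _))) (bound Q e R eq)))
    where
    -- `x` is the gain of the part of the walk already traversed.
    go : ∀ x P → (∀ Q e R → P ≡ Q ++ e ∷ R → (x * walkGain Q) * r e ≤ f e) →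
         x * walkSum r P ≤ sumOver f P
    go x [] bound = ≤-reflexive (zeroʳ x)
    go x (e ∷ P) bound = ≤-trans
      (≤-reflexive (solve 4 (λ x y g s → x :* (y :+ g :* s) := (x :* con (+ 1)) :* y :+ (x :* g) :* s)
                      refl x (r e) (gain e) (walkSum r P)))
      (+-mono-≤ (bound [] e P ≡.refl) (go (x * gain e) P (λ Q d R eq → ≤-trans
        (≤-reflexive (*-congʳ (*-assoc x (gain e) (walkGain Q))))
        (bound (e ∷ Q) d R (≡.cong (e ∷_) eq)))))

  walk-split : ∀ {v w e} Q {R} → IsWalk v (Q ++ e ∷ R) w →
               IsWalk v Q (tail e) × IsWalk (tail e) (e ∷ R) w
  walk-split [] (e∈S , ≡.refl , walk) = ≡.refl , e∈S , ≡.refl , walk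
  walk-split (d ∷ Q) (d∈S , td , walk) with walk-split Q walk
  ... | walk₁ , walk₂ = (d∈S , td , walk₁) , walk₂

  walk-⊆ : ∀ {v w} P → IsWalk v P w → ∀ {e} → e List.∈ P → e ∈ S
  walk-⊆ (e ∷ P) (e∈S , _ , _)  (here ≡.refl) = e∈S
  walk-⊆ (e ∷ P) (_ , _ , walk) (there e∈P)   = walk-⊆ P walk e∈P

  potential : Labels n → Fin n → Carrier
  potential z v = finitePart (z v)

  -- The outcome of a successful run of Grapevine.
  record Snapshot : Set (c ⊔ ℓ₁ ⊔ ℓ₂) where
    field
      labels   : Labels n
      δ t      : Carrier
      walk     : List (Fin m)
      sink≡    : labels sink ≡ [ δ ]
      source≡  : labels source ≡ [ t ]
      feasible : Feasible labels
      isWalk   : IsWalk source walk sink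
      tight    : All (Tight labels) walk
      unique   : Unique walk

    π : Fin n → Carrier
    π = potential labels

    tangentLine : Tangent
    tangentLine = tangent δ (t - δ) (walkGain walk - 1#)

  open Snapshot

  -- Feasibility carries finiteness from the sink back along the walk, so `potential` does not read
  -- its default value there. The walk may come from a snapshot other than the one with labels `z`.
  finite-along : ∀ {z v} P → Feasible z → Finite (z sink) → IsWalk v P sink →
                 Finite (z v) × All (λ e → 0# ≤ reducedCost (potential z) e) P
  finite-along [] _ fin ≡.refl = fin , []
  finite-along {z} (e ∷ P) feas fin (e∈S , ≡.refl , walk) with finite-along {z} P feas fin walk
  ... | head-finite , nonneg = ≤⁺-finite (feas e∈S) (arcValue-finite z e head-finite) ,
    ≤⇒0≤- (finitePart-feasible {z} feas e∈S head-finite) ∷ nonneg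

  reducedCost-nonneg : ∀ X Y → All (λ e → 0# ≤ reducedCost (π Y) e) (walk X)
  reducedCost-nonneg X Y = proj₂ (finite-along {labels Y} (walk X) (feasible Y) (_ , sink≡ Y) (isWalk X))

  tight⇒≈0 : ∀ {z e} → Tight z e → 0# ≤ reducedCost (potential z) e → reducedCost (potential z) e ≈ 0#
  tight⇒≈0 {z} {e} (fin , le) nonneg with finite-head z e (≤⁺-finite le fin)
  ... | _ , eq = ≤-antisym (≤-by (≤⇒0≤- (≤-trans
      (≤-reflexive (reflexive (≡.cong finitePart (≡.cong (Maybe.map _) (≡.sym (finitePart-finite (_ , eq)))))))
      (finitePart-mono le fin)))
    (solve 2 (λ x y → con (+ 0) :- (x :- y) := y :- x) refl _ _)) nonneg

  reducedCost-tight : ∀ X → All (λ e → reducedCost (π X) e ≈ 0#) (walk X)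
  reducedCost-tight X = All.zipWith (λ (t , n) → tight⇒≈0 {labels X} t n) (tight X , reducedCost-nonneg X X)

  walkSum-of-tight : ∀ p q {v w} Q → IsWalk v Q w → All (λ e → reducedCost q e ≈ 0#) Q →
    walkSum (reducedCost p) Q ≈ walkGain Q * (p w - q w) - (p v - q v)
  walkSum-of-tight p q Q isWalk zero-cost = trans
    (sym (trans (+-congˡ (trans (-‿cong (walkSum-zero zero-cost)) -0#≈0#)) (+-identityʳ _)))
    (walkSum-telescopes p q Q isWalk)

  -- Under its own labels the walk sum of `X` is zero by tightness, so telescoping leaves walkGain
  -- (walk X) * (δ Z - δ X) - (t Z - t X), which is the divergence.
  divergence≈walkSum : ∀ X Z →
    divergence (tangentLine X) (tangentLine Z) ≈ walkSum (reducedCost (π Z)) (walk X)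
  divergence≈walkSum X Z = sym (trans (walkSum-of-tight (π Z) (π X) (walk X) (isWalk X) (reducedCost-tight X))
    (trans (+-cong (*-congˡ (+-cong (π-sink Z) (-‿cong (π-sink X)))) (-‿cong (+-cong (π-source Z) (-‿cong (π-source X)))))
      (solve 5 (λ g d d′ t t′ → g :* (d′ :- d) :- (t′ :- t)
                  := (t :- d) :+ (g :- con (+ 1)) :* (d′ :- d) :- (t′ :- d′))
         refl (walkGain (walk X)) (δ X) (δ Z) (t X) (t Z))))
    where
    π-sink : ∀ X → π X sink ≈ δ X
    π-sink X = reflexive (≡.cong finitePart (sink≡ X))
    π-source : ∀ X → π X source ≈ t X
    π-source X = reflexive (≡.cong finitePart (source≡ X))

  divergence-nonneg : ∀ X Z → 0# ≤ divergence (tangentLine X) (tangentLine Z)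
  divergence-nonneg X Z = 0≤-resp-≈ (sym (divergence≈walkSum X Z)) (walkSum-nonneg (reducedCost-nonneg X Z))

  -- Labels decrease with the label of the sink, and a walk that is optimal for
  -- a smaller label of its end has a larger gain.
  prefix-gain-mono : ∀ X Y {e} Q {R} Q′ {R′} → δ Y < δ X →
    walk X ≡ Q ++ e ∷ R → walk Y ≡ Q′ ++ e ∷ R′ → walkGain Q ≤ walkGain Q′
  prefix-gain-mono X Y {e} Q {R} Q′ {R′} δY<δX eqX eqY =
    0≤-⇒≤ (0≤*⇒0≤ (<⇒0<- decrease) (0≤-resp-≈
      (solve 6 (λ k k′ x y s s′ → (k :* (y :- x) :- (s′ :- s)) :+ (k′ :* (x :- y) :- (s :- s′))
                                 := (x :- y) :* (k′ :- k)) refl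
        (walkGain Q) (walkGain Q′) (π X (tail e)) (π Y (tail e)) (π X source) (π Y source))
      (0≤+0≤ (sub X Y Q eqX) (sub Y X Q′ eqY))))
    where
    walkOf : ∀ X {e} Q {R} → walk X ≡ Q ++ e ∷ R →
             IsWalk source Q (tail e) × IsWalk (tail e) (e ∷ R) sink
    walkOf X Q eq = walk-split Q (≡.subst (λ P → IsWalk source P sink) eq (isWalk X))

    sub : ∀ X Y {e} Q {R} → walk X ≡ Q ++ e ∷ R →
          0# ≤ walkGain Q * (π Y (tail e) - π X (tail e)) - (π Y source - π X source)
    sub X Y Q eq = 0≤-resp-≈
      (walkSum-of-tight (π Y) (π X) Q (proj₁ (walkOf X Q eq)) (++⁻ˡ Q (≡.subst (All _) eq (reducedCost-tight X))))
      (walkSum-nonneg (++⁻ˡ Q (≡.subst (All _) eq (reducedCost-nonneg X Y))))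

    -- The rest of the walk of `X`, from `e` to the sink, is tight for `X` and has nonnegative
    -- reduced costs for `Y`. So the label at `tail e` drops by at least the gain of that rest times
    -- δ X - δ Y.
    decrease : π Y (tail e) < π X (tail e)
    decrease = <-by (0<+0≤ (*-pos (walkGain-pos (e ∷ R)) (<⇒0<- δY<δX))
        (0≤-resp-≈ (walkSum-of-tight (π Y) (π X) (e ∷ R) (proj₂ (walkOf X Q eqX))
                     (++⁻ʳ Q (≡.subst (All _) eqX (reducedCost-tight X))))
          (walkSum-nonneg (++⁻ʳ Q (≡.subst (All _) eqX (reducedCost-nonneg X Y))))))
      (trans (solve 5 (λ k d d′ x y → x :- y := k :* (d :- d′) :+ (k :* (d′ :- d) :- (y :- x)))
                refl (walkGain (e ∷ R)) (δ X) (δ Y) (π X (tail e)) (π Y (tail e)))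
        (+-congˡ (+-congʳ (*-congˡ (+-cong (reflexive (≡.cong finitePart (≡.sym (sink≡ Y))))
                                          (-‿cong (reflexive (≡.cong finitePart (≡.sym (sink≡ X))))))))))

  -- The walk of `X` bounds `s` by t X - walkGain (walk X) * (δ X - d). The strict drop is what
  -- later forces the walk of Grapevine to reach the sink.
  source-decreases : ∀ X {z d s} → Feasible z → z sink ≡ [ d ] → z source ≡ [ s ] → d < δ X → s < t X
  source-decreases X {z} {d} {s} feas sinkEq sourceEq d<δ =
    <-by (0<+0≤ (*-pos (walkGain-pos (walk X)) (<⇒0<- d<δ))
                (walkSum-nonneg (proj₂ (finite-along {z} (walk X) feas (_ , sinkEq) (isWalk X)))))
      (trans (solve 5 (λ k d d′ x y → x :- y := k :* (d :- d′) :+ (k :* (d′ :- d) :- (y :- x)))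
                refl (walkGain (walk X)) (δ X) d (t X) s)
        (+-congˡ (sym (trans
          (walkSum-of-tight (potential z) (π X) (walk X) (isWalk X) (reducedCost-tight X))
          (reflexive (≡.cong₂ (λ p q → walkGain (walk X) * p - q)
            (≡.cong₂ (λ x y → finitePart x - finitePart y) sinkEq (sink≡ X))
            (≡.cong₂ (λ x y → finitePart x - finitePart y) sourceEq (source≡ X))))))))

  -- X is the earliest of k + 1 snapshots before Z; the divergences of the later
  -- ones have been recorded on the arcs of their walks.
  record Frontier (Z X : Snapshot) (k : ℕ) : Set (c ⊔ ℓ₁ ⊔ ℓ₂) where
    D : Carrier
    D = divergence (tangentLine X) (tangentLine Z)
    field
      records  : Records m
      positive : 0# < D
      nonneg   : ∀ e → 0# ≤ recorded (records e)
      confined   : ∀ e → e ∉ S → records e ≡ nothing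
      credits  : k · D ≤ sum (λ e → credit D (records e))
      -- `Y` ranges over all snapshots to the right of `X`, not only over iterates, so no list of
      -- the earlier iterates has to be carried.
      dominate : ∀ Y → δ X < δ Y → ∀ Q e R → walk Y ≡ Q ++ e ∷ R →
                 ∀ w → records e ≡ just w → walkGain Q * reducedCost (π Z) e ≤ w

  frontier-start : ∀ {Z X} → 0# < divergence (tangentLine X) (tangentLine Z) → Frontier Z X 0
  frontier-start pos = record
    { records = λ _ → nothing ; positive = pos ; nonneg = λ _ → ≤-reflexive refl ; confined = λ _ _ → ≡.refl
    ; credits = ≤-reflexive (sym (sum-replicate-zero m)) ; dominate = λ _ _ _ _ _ _ _ () }

  -- Each term of the walk sum of `X′` is covered by the record of its arc: an older record by
  -- `dominate`, a new one because a single term is at most the whole divergence. So the records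
  -- along the walk of `X′` add up to at least its divergence, as `total-credit` requires.
  frontier-advance : ∀ {Z X X′ k} → Frontier Z X k → δ X < δ X′ →
    let D = divergence (tangentLine X) (tangentLine Z) ; D′ = divergence (tangentLine X′) (tangentLine Z) in
    0# < D′ → D + (D + D) ≤ D′ + D′ → Frontier Z X′ (ℕ.suc k)
  frontier-advance {Z} {X} {X′} {k} front δX<δX′ pos 3D≤2D′ = record
    { records  = record-use D′ (walk X′) records
    ; positive = pos
    ; nonneg   = λ e → update-nonneg (e ∈ˡ? walk X′) (records e) (<⇒≤ pos) (nonneg e)
    ; confined   = confined′
    ; credits  = total-credit {k = k} {P = walk X′} {A = records} pos positive 3D≤2D′ nonneg (unique X′)
                   (≤-trans (≤-reflexive (divergence≈walkSum X′ Z))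
                     (walkSum-≤-sumOver {f = λ e → recorded (record-use D′ (walk X′) records e)} (walk X′)
                       λ Q e R eq → covers Q e R eq (e ∈ˡ? walk X′) (records e) ≡.refl))
                   credits
    ; dominate = λ Y δX′<δY Q e R eq w → dominate′ Y δX′<δY Q e R eq w (e ∈ˡ? walk X′) (records e) ≡.refl
    }
    where
    open Frontier front
    D′ = divergence (tangentLine X′) (tangentLine Z)

    term≤D′ : ∀ Q e R → walk X′ ≡ Q ++ e ∷ R → walkGain Q * reducedCost (π Z) e ≤ D′
    term≤D′ Q e R eq = ≤-trans (walkSum-term Q (≡.subst (All _) eq (reducedCost-nonneg X′ Z)))
      (≤-reflexive (sym (trans (divergence≈walkSum X′ Z) (reflexive (≡.cong (walkSum _) eq)))))

    covers : ∀ Q e R → walk X′ ≡ Q ++ e ∷ R → (e∈? : Dec (e List.∈ walk X′)) → ∀ a → records e ≡ a →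
             walkGain Q * reducedCost (π Z) e ≤ recorded (update D′ e∈? a)
    covers Q e R eq _       (just w) rec = dominate X′ δX<δX′ Q e R eq w rec
    covers Q e R eq (yes _) nothing  _   = term≤D′ Q e R eq
    covers Q e R eq (no ∉)  nothing  _   = contradiction (≡.subst (e List.∈_) (≡.sym eq) (∈-++⁺ʳ Q (here ≡.refl))) ∉

    confined′ : ∀ e → e ∉ S → record-use D′ (walk X′) records e ≡ nothing
    confined′ e e∉S with e ∈ˡ? walk X′
    ... | yes e∈P = contradiction (walk-⊆ (walk X′) (isWalk X′) e∈P) e∉S
    ... | no  _   = ≡.cong (update D′ _) (confined e e∉S)

    dominate′ : ∀ Y → δ X′ < δ Y → ∀ Q e R → walk Y ≡ Q ++ e ∷ R → ∀ w →
                (e∈? : Dec (e List.∈ walk X′)) → ∀ a → records e ≡ a →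
                update D′ e∈? a ≡ just w → walkGain Q * reducedCost (π Z) e ≤ w
    dominate′ Y δX′<δY Q e R eq w _ (just _) rec ≡.refl = dominate Y (<-trans δX<δX′ δX′<δY) Q e R eq w rec
    -- The record was made just now, at `X′`. The prefix gain in `Y` is at most the one in `X′`,
    -- whose term is at most `D′`.
    dominate′ Y δX′<δY Q e R eq w (yes e∈P) nothing _ ≡.refl with ∈-∃++ e∈P
    ... | Q′ , R′ , eq′ = ≤-trans
      (≤-by (0≤*0≤ (≤⇒0≤- (prefix-gain-mono Y X′ Q Q′ δX′<δY eq eq′))
                   (All.lookup (reducedCost-nonneg X′ Z) e∈P))
        (solve 3 (λ k k′ x → k′ :* x :- k :* x := (k′ :- k) :* x) refl (walkGain Q) (walkGain Q′) (reducedCost (π Z) e)))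
      (term≤D′ Q′ e R′ eq′)

  -- An arc of `S` holds credit at most 3D and other arcs hold none; cancelling D leaves 3 per arc.
  frontier-bound : ∀ {Z X k} → Frontier Z X k → k ℕ.≤ ∣ S ∣ ℕ.* 3
  frontier-bound {Z} {X} {k} front = ·-cancel-≤ positive k (∣ S ∣ ℕ.* 3)
    (≤-trans credits (≤-trans (sum≤card S (λ {e} _ → credit≤ (records e) (nonneg e))
        (λ {e} e∉S → ≤-reflexive (reflexive (≡.cong (credit D) (confined e e∉S)))))
      (≤-reflexive (×-assocˡ D ∣ S ∣ 3))))
    where
    open Frontier front
    0≤3D : 0# ≤ 3 · D
    0≤3D = ·-nonneg positive 3

    credit≤ : ∀ a → 0# ≤ recorded a → credit D a ≤ 3 · D
    credit≤ nothing  _   = 0≤3D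
    credit≤ (just w) 0≤w = ≤-by (0≤+0≤ 0≤w 0≤w)
      (solve 2 (λ D w → (D :+ (D :+ (D :+ con (+ 0)))) :- (D :+ (D :+ D) :- (w :+ w)) := w :+ w) refl D w)

-- The Newton-Dinkelbach iterates of one phase.

module NewtonPhase {c ℓ₁ ℓ₂} (F : OrderedField c ℓ₁ ℓ₂)
                   {n m : ℕ} (G : M2VPI.System F n m) (S : Subset m) (u : Fin n) where
  open OrderedField F hiding (zero)
  open OrderedFieldProperties F
  open IntegerCoefficients commutativeRing
  open Solver using (solve; _:=_; _:+_; _:*_; _:-_; :-_; con)
  open ExtendedOrder F
  open Tangents F
  open M2VPI F
  open Algorithm G
  open Phase S u hiding (solve)
  private module Hᵤ = Subgraph (split u) S
  open Grapevine F (split u) S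
  open Snapshots F (split u) S (suc u) zero
  open Snapshot
  open Tangent using () renaming (slope to slopeOf; value to valueOf)

  isSink : ∀ e → suc (System.tail G e) ≢ zero
  isSink e ()

  setSink-other : ∀ d y {v} → v ≢ zero → setSink d y v ≡ y v
  setSink-other d y v≢0 = updateAt-minimal _ zero y v≢0

  toState : Snapshot → State
  toState X = state (δ X) (t X - δ X) (walkGain (walk X) - 1#) (labels X)
    where open Hᵤ

  infix 4 _⊒_
  _⊒_ : Snapshot → Snapshot → Set (c ⊔ ℓ₂)
  X ⊒ Y = ∀ v → labels Y v ≤⁺ labels X v

  ⊒⇒≤ : ∀ {X Y} → X ⊒ Y → δ Y ≤ δ X
  ⊒⇒≤ {X} {Y} X⊒Y = [≤]-injective (≡.subst₂ _≤⁺_ (sink≡ Y) (sink≡ X) (X⊒Y zero))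

  setSink-≤ : ∀ X {d} → d ≤ δ X → ∀ v → setSink d (labels X) v ≤⁺ labels X v
  setSink-≤ X d≤δ zero    = ≡.subst (_ ≤⁺_) (≡.sym (sink≡ X)) [ d≤δ ]
  setSink-≤ X d≤δ (suc v) = ≤⁺-refl

  slope-at-sink : ∀ P → Hᵤ.endpoint (suc u) P ≡ zero → slope P ≡ Hᵤ.walkGain P - 1#
  slope-at-sink P eq rewrite eq = ≡.refl

  Answers : Snapshot → Carrier → Carrier → Carrier → Labels (ℕ.suc n) → Snapshot → Set (c ⊔ ℓ₂)
  Answers X d f g μ Y =
    X ⊒ Y × δ Y ≡ d × f ≡ t Y - δ Y × g ≡ Hᵤ.walkGain (walk Y) - 1# × μ ≡ labels Y

  -- Arcs not entering u′ stay satisfied when the sink label is lowered to `d`, so a walk stopping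
  -- short of u′ would leave the label of `u` no lower than before; but `source-decreases` makes it
  -- drop strictly. Hence the walk ends at u′ and the slope is its gain minus one.
  oracle-snapshot : ∀ X {d f g μ} → d < δ X → Oracle (labels X) d (value f g) μ →
                    ∃ (Answers X d f g μ)
  oracle-snapshot X {d} d<δ (finite {t = s} {P} ¬violated source-eq runWalk) =
    snapshot , X⊒Y , ≡.refl , ≡.refl , slope-at-sink P ends , ≡.refl
    where
    y₀ = setSink d (labels X)
    z  = run y₀
    z-feasible : Feasible z
    z-feasible = ¬violated⇒feasible {z} ¬violated
    module T = TraceProperties (walk-properties {y₀} {n} z-feasible runWalk)

    sink-eq : z zero ≡ [ d ]
    sink-eq = grapevine-sink isSink y₀ n

    X⊒Y : ∀ v → z v ≤⁺ labels X v
    X⊒Y v = ≤⁺-transitive (grapevine-≤ {0} {n} y₀ v ℕ.z≤n) (setSink-≤ X (<⇒≤ d<δ) v)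

    y₀-feasible : ∀ {e} → e ∈ S → System.head (split u) e ≢ zero →
                  y₀ (suc (System.tail G e)) ≤⁺ Hᵤ.arcValue y₀ e
    y₀-feasible {e} e∈S h≢0 = ≤⁺-transitive (feasible X e∈S)
      (arcValue-mono (labels X) y₀ e (≤⁺-reflexive (≡.sym (setSink-other d (labels X) h≢0))))

    not-constant : ¬ (y₀ (suc u) ≤⁺ z (suc u))
    not-constant le = [≤]-injective (≡.subst₂ _≤⁺_ (source≡ X) source-eq le)
      (source-decreases X {z} z-feasible sink-eq source-eq d<δ)

    ends : Hᵤ.endpoint (suc u) P ≡ zero
    ends with walk-ends-at-sink y₀ z P isSink y₀-feasible T.tight T.walk T.end
    ... | inj₁ eq = eq
    ... | inj₂ le = contradiction le not-constant

    snapshot : Snapshot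
    snapshot = record
      { labels = z ; δ = d ; t = s ; walk = P ; sink≡ = sink-eq ; source≡ = source-eq
      ; feasible = z-feasible ; isWalk = ≡.subst (Hᵤ.IsWalk (suc u) P) ends T.walk
      ; tight = T.tight ; unique = T.unique }

  oracle-exists : ∀ X d → ∃[ b ] ∃[ μ ] Oracle (labels X) d b μ
  oracle-exists X d with violated? (run (setSink d (labels X)))
  ... | yes violated = _ , _ , infinite violated
  ... | no ¬violated with ≤⁺-finite (grapevine-≤ {0} {n} (setSink d (labels X)) (suc u) ℕ.z≤n) (_ , source≡ X)
  ...   | _ , eq = _ , _ , finite ¬violated eq (proj₂ (walk-exists n _ (suc u)))

  -- If `Z` lay strictly below `d`, the start labels would lie between the feasible labels of `Z`
  -- and of `X`, and n rounds would leave no violated arc.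
  oracle-infinite : ∀ X Z {d μ} → d < δ X → X ⊒ Z → Oracle (labels X) d -∞ μ → d ≤ δ Z
  oracle-infinite X Z {d} d<δ X⊒Z (infinite violated) Z<d =
    Stabilisation.stabilises F (split u) S (λ _ ()) {labels Z} {y₀} {labels X}
      (feasible Z) (feasible X) below (setSink-≤ X (<⇒≤ d<δ)) finite-X violated
    where
    y₀ = setSink d (labels X)
    below : ∀ v → labels Z v ≤⁺ y₀ v
    below zero    = ≡.subst (_≤⁺ [ d ]) (≡.sym (sink≡ Z)) [ <⇒≤ Z<d ]
    below (suc v) = X⊒Z (suc v)
    finite-X : ∀ v → Finite (y₀ v) → Finite (labels X v)
    finite-X zero    _   = _ , sink≡ X
    finite-X (suc v) fin = fin

  -- h is the length of the Newton step.  The last condition of stepped is what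
  -- the rejection of the look-ahead point says about all later iterates.
  data Link (X Y : Snapshot) : Set (c ⊔ ℓ₁ ⊔ ℓ₂) where
    stepped : ∀ {h} → 0# < h → X ⊒ Y → Negative (tangentLine X) →
              NewtonStep h (tangentLine X) (tangentLine Y) →
              (∀ Z → Y ⊒ Z → Negative (tangentLine Z) → δ X - (h + h) ≤ δ Z) → Link X Y
    jumped  : ∀ {h} → 0# < h → X ⊒ Y → Negative (tangentLine X) →
              DoubleStep h (tangentLine X) (tangentLine Y) → Link X Y

  link-⊒ : ∀ {X Y} → Link X Y → X ⊒ Y
  link-⊒ (stepped _ X⊒Y _ _ _) = X⊒Y
  link-⊒ (jumped _ X⊒Y _ _)    = X⊒Y

  link-negative : ∀ {X Y} → Link X Y → Negative (tangentLine X)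
  link-negative (stepped _ _ neg _ _) = neg
  link-negative (jumped _ _ neg _)    = neg

  link-< : ∀ {X Y} → Link X Y → δ Y < δ X
  link-< {X} {Y} (stepped {h} 0<h _ _ (newtonStep p _) _) = <-by 0<h (trans (+-congʳ p)
    (solve 2 (λ y h → y :+ h :- y := h) refl (δ Y) h))
  link-< {X} {Y} (jumped {h} 0<h _ _ (doubleStep p _)) = <-by (0<+0≤ 0<h (<⇒≤ 0<h)) (trans (+-congʳ p)
    (solve 2 (λ y h → y :+ (h :+ h) :- y := h :+ h) refl (δ Y) h))

  D : Snapshot → Snapshot → Carrier
  D X Z = divergence (tangentLine X) (tangentLine Z)

  link-slope : ∀ {X Y} → Link X Y → slopeOf (tangentLine X) ≤ slopeOf (tangentLine Y)
  link-slope {X} {Y} l = slope-antitone {tangentLine X} {tangentLine Y}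
    (divergence-nonneg X Y) (divergence-nonneg Y X) (link-< l)

  module _ (Z : Snapshot) (negZ : Negative (tangentLine Z)) where

    value≤ : ∀ {Y} → Y ⊒ Z → valueOf (tangentLine Y) ≤ valueOf (tangentLine Z)
    value≤ {Y} Y⊒Z = value-antitone {tangentLine Y} {tangentLine Z}
      (divergence-nonneg Z Y) (proj₂ negZ) (⊒⇒≤ {Y} {Z} Y⊒Z)

    divergence-pos : ∀ {X Y} → Link X Y → Y ⊒ Z → 0# < D X Z
    divergence-pos {X} {Y} (stepped _ _ neg s _) Y⊒Z = step-divergence-pos s neg negZ (⊒⇒≤ {Y} {Z} Y⊒Z)
    divergence-pos {X} {Y} (jumped _ _ neg s)    Y⊒Z = double-divergence-pos s neg negZ (⊒⇒≤ {Y} {Z} Y⊒Z)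

    private
      halved : ∀ {x y} → 0# ≤ x → x + x ≤ y → x + (x + x) ≤ y + y
      halved {x} {y} 0≤x 2x≤y = ≤-by (0≤+0≤ (0≤+0≤ (≤⇒0≤- 2x≤y) (≤⇒0≤- 2x≤y)) 0≤x)
        (solve 2 (λ x y → y :+ y :- (x :+ (x :+ x)) := ((y :- (x :+ x)) :+ (y :- (x :+ x))) :+ x) refl x y)

      weaken : ∀ {x y z} → y ≤ z → x + (x + x) ≤ y + y → x + (x + x) ≤ z + z
      weaken {x} {y} {z} y≤z p = ≤-by (0≤+0≤ (≤⇒0≤- p) (0≤+0≤ (≤⇒0≤- y≤z) (≤⇒0≤- y≤z)))
        (solve 3 (λ x y z → z :+ z :- (x :+ (x :+ x)) := (y :+ y :- (x :+ (x :+ x))) :+ ((z :- y) :+ (z :- y)))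
           refl x y z)

      triple : ∀ {x y z} → x ≤ y → y + (y + y) ≤ z + z → x + (x + x) ≤ z + z
      triple {x} {y} {z} x≤y p = ≤-by (0≤+0≤ (≤⇒0≤- p) (0≤+0≤ (≤⇒0≤- x≤y) (0≤+0≤ (≤⇒0≤- x≤y) (≤⇒0≤- x≤y))))
        (solve 3 (λ x y z → z :+ z :- (x :+ (x :+ x))
                    := (z :+ z :- (y :+ (y :+ y))) :+ ((y :- x) :+ ((y :- x) :+ (y :- x))))
           refl x y z)

    jump-halves : ∀ {h X Y} → 0# < h → DoubleStep h (tangentLine X) (tangentLine Y) →
      Negative (tangentLine X) → Negative (tangentLine Y) → Y ⊒ Z → D Y Z + D Y Z ≤ D X Z
    jump-halves {h} {X} {Y} 0<h s negX negY Y⊒Z = double-divergence {Z = tangentLine Z} 0<h s negX negY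
      (divergence-nonneg Y X) (value≤ {Y} Y⊒Z) (⊒⇒≤ {Y} {Z} Y⊒Z)

    link-decreases : ∀ {X Y} → Link X Y → Negative (tangentLine Y) → Y ⊒ Z → D Y Z ≤ D X Z
    link-decreases {X} {Y} l@(stepped _ _ _ s _) negY Y⊒Z =
      step-divergence-≤ {Z = tangentLine Z} s (link-slope {X} {Y} l) negY (⊒⇒≤ {Y} {Z} Y⊒Z)
    link-decreases {X} {Y} (jumped 0<h _ negX s) negY Y⊒Z = ≤-trans
      (≤-by (divergence-nonneg Y Z) (solve 1 (λ x → x :+ x :- x := x) refl _))
      (jump-halves {X = X} {Y} 0<h s negX negY Y⊒Z)

    -- A jump halves the divergence, and the other link does not increase it. For two plain steps
    -- the factor 2/3 comes from the first, but it relies on the rejected look-ahead from `Y`, which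
    -- is recorded in the second; hence links are taken in pairs.
    two-links : ∀ {X Y W} → Link X Y → Link Y W → Negative (tangentLine W) → W ⊒ Z →
                D W Z + (D W Z + D W Z) ≤ D X Z + D X Z
    two-links {X} {Y} {W} l l′@(jumped 0<h Y⊒W negY s) negW W⊒Z =
      weaken (link-decreases {X} {Y} l negY (λ v → ≤⁺-transitive (W⊒Z v) (Y⊒W v)))
        (halved (divergence-nonneg W Z) (jump-halves {X = Y} {W} 0<h s negY negW W⊒Z))
    two-links {X} {Y} {W} (jumped 0<h _ negX s) l′@(stepped _ Y⊒W negY _ _) negW W⊒Z =
      triple (link-decreases {Y} {W} l′ negW W⊒Z)
        (halved (divergence-nonneg Y Z) (jump-halves {X = X} {Y} 0<h s negX negY
          (λ v → ≤⁺-transitive (W⊒Z v) (Y⊒W v))))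
    two-links {X} {Y} {W} l@(stepped _ _ negX s _) l′@(stepped _ Y⊒W negY s′ below) negW W⊒Z =
      triple (link-decreases {Y} {W} l′ negW W⊒Z)
        (step-step-divergence {W = tangentLine W} {Z = tangentLine Z} s s′ (link-slope {X} {Y} l) negY
          (value≤ {Y} Y⊒Z) (⊒⇒≤ {Y} {Z} Y⊒Z) (below Z W⊒Z negZ))
      where
      Y⊒Z : Y ⊒ Z
      Y⊒Z v = ≤⁺-transitive (W⊒Z v) (Y⊒W v)

  data History : Snapshot → ℕ → Set (c ⊔ ℓ₁ ⊔ ℓ₂) where
    here  : ∀ {X} → History X 0
    _then_ : ∀ {X Y k} → History X k → Link X Y → History Y (ℕ.suc k)

  -- Links are consumed two at a time from `Z` backwards, one frontier step per pair. The summand 2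
  -- accounts for the link into `Z`, which opens the frontier because the divergence of `Z` from
  -- itself is zero, and for an unpaired first link.
  history-bound : ∀ {Z k} → Negative (tangentLine Z) → History Z k → k ℕ.≤ 2 ℕ.+ 2 ℕ.* (∣ S ∣ ℕ.* 3)
  history-bound negZ here = ℕ.z≤n
  history-bound {Z} negZ (_then_ {X = X} H l) =
    ℕ.s≤s (≡.subst (ℕ._≤ 1 ℕ.+ 2 ℕ.* (∣ S ∣ ℕ.* 3)) (ℕ.+-identityʳ _)
      (go X (link-negative l) (link-⊒ l) (frontier-start {Z} {X} (divergence-pos Z negZ {X} {Z} l (λ _ → ≤⁺-refl))) H))
    where
    go : ∀ X {j k} → Negative (tangentLine X) → X ⊒ Z → Frontier Z X k → History X j →
         j ℕ.+ 2 ℕ.* k ℕ.≤ 1 ℕ.+ 2 ℕ.* (∣ S ∣ ℕ.* 3)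
    go X neg X⊒Z front here = ℕ.m≤n⇒m≤1+n (ℕ.*-monoʳ-≤ 2 (frontier-bound {Z} {X} front))
    go X neg X⊒Z front (here then _) = ℕ.s≤s (ℕ.*-monoʳ-≤ 2 (frontier-bound {Z} {X} front))
    go X {k = k} neg X⊒Z front (_then_ {X = X₁} (_then_ {X = X₂} {k = j} H l₂) l₁) =
      ≡.subst (ℕ._≤ 1 ℕ.+ 2 ℕ.* (∣ S ∣ ℕ.* 3)) (≡.trans (≡.cong (j ℕ.+_) (ℕ.*-suc 2 k))
                                (≡.trans (ℕ.+-suc j _) (≡.cong ℕ.suc (ℕ.+-suc j _))))
        (go X₂ (link-negative l₂) X₂⊒Z (frontier-advance {Z} {X} {X₂} front
          (<-trans (link-< {X₁} {X} l₁) (link-< {X₂} {X₁} l₂))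
          (divergence-pos Z negZ {X₂} {X₁} l₂ X₁⊒Z)
          (two-links Z negZ {X₂} {X₁} {X} l₂ l₁ neg X⊒Z)) H)
      where
      X₁⊒Z : X₁ ⊒ Z
      X₁⊒Z v = ≤⁺-transitive (X⊒Z v) (link-⊒ {X₁} {X} l₁ v)
      X₂⊒Z : X₂ ⊒ Z
      X₂⊒Z v = ≤⁺-transitive (X₁⊒Z v) (link-⊒ {X₂} {X₁} l₂ v)

  Settled : Snapshot → Set (ℓ₁ ⊔ ℓ₂)
  Settled X = valueOf (tangentLine X) ≈ 0# ⊎ Negative (tangentLine X)

  -- One iteration from a negative iterate.

  module NewtonIteration (X : Snapshot) (negX : Negative (tangentLine X)) where
    f = t X - δ X
    g = Hᵤ.walkGain (walk X) - 1#
    h = f * g ⁻¹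
    δ₁ = newton (δ X) f g
    δ₂ = lookAhead δ₁ (δ X)

    f≈hg : f ≈ h * g
    f≈hg = sym (trans (*-assoc f (g ⁻¹) g)
      (trans (*-congˡ (trans (*-comm (g ⁻¹) g) (⁻¹-inverseʳ (λ g≈0 → <-irrefl g≈0 (proj₂ negX)))))
             (*-identityʳ f)))

    0<h : 0# < h
    0<h = 0<*⇒0< (<-respʳ-≈ (+-identityˡ _) (<⇒0<- (proj₂ negX)))
      (<-respʳ-≈ (trans (+-congˡ (-‿cong f≈hg))
                   (solve 2 (λ g h → con (+ 0) :- h :* g := (:- g) :* h) refl g h))
                 (<⇒0<- (proj₁ negX)))

    δ₁<δ : δ₁ < δ X
    δ₁<δ = <-by 0<h (solve 2 (λ d h → d :- (d :- h) := h) refl (δ X) h)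

    δ₂<δ₁ : δ₂ < δ₁
    δ₂<δ₁ = <-by 0<h (solve 2 (λ d h → (d :- h) :- ((d :- h) :+ (d :- h) :- d) := h) refl (δ X) h)

    newton-step : ∀ Y → δ Y ≡ δ₁ → NewtonStep h (tangentLine X) (tangentLine Y)
    newton-step Y eq = newtonStep
      (trans (solve 2 (λ d h → d := d :- h :+ h) refl (δ X) h) (+-congʳ (reflexive (≡.sym eq)))) f≈hg

    double-step : ∀ Y → δ Y ≡ δ₂ → DoubleStep h (tangentLine X) (tangentLine Y)
    double-step Y eq = doubleStep
      (trans (solve 2 (λ d h → d := ((d :- h) :+ (d :- h) :- d) :+ (h :+ h)) refl (δ X) h)
             (+-congʳ (reflexive (≡.sym eq)))) f≈hg

    δ₂≈ : δ₂ ≈ δ X - (h + h)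
    δ₂≈ = solve 2 (λ d h → (d :- h) :+ (d :- h) :- d := d :- (h :+ h)) refl (δ X) h

    lookAhead-snapshot : ∀ Y {f₂ g₂ μ₂} → δ Y ≡ δ₁ → Oracle (labels Y) δ₂ (value f₂ g₂) μ₂ →
                         ∃ (Answers Y δ₂ f₂ g₂ μ₂)
    lookAhead-snapshot Y eq = oracle-snapshot Y (≡.subst (δ₂ <_) (≡.sym eq) δ₂<δ₁)

    -- The answer `-∞` is handled by `oracle-infinite`. A finite answer belongs to a snapshot `W`,
    -- and a negative `Z` to the left of `W` would make `W` negative as well, hence accepted.
    rejected : ∀ {Y b μ} → δ Y ≡ δ₁ → Oracle (labels Y) δ₂ b μ → ¬ Accepted b →
               ∀ Z → Y ⊒ Z → Negative (tangentLine Z) → δ X - (h + h) ≤ δ Z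
    rejected {Y} { -∞ } eq oracle _ Z Y⊒Z negZ = ≤-trans (≤-reflexive (sym δ₂≈))
      (oracle-infinite Y Z (≡.subst (δ₂ <_) (≡.sym eq) δ₂<δ₁) Y⊒Z oracle)
    rejected {Y} {value f₂ g₂} {μ} eq oracle ¬accepted Z Y⊒Z negZ Z< =
      absurd (lookAhead-snapshot Y eq oracle)
      where
      absurd : ¬ ∃ (Answers Y δ₂ f₂ g₂ μ)
      absurd (W , _ , eqW , ≡.refl , ≡.refl , _) = ¬accepted
        (negative-before {tangentLine W} {tangentLine Z} (divergence-nonneg W Z) (divergence-nonneg Z W)
          (<-respʳ-≈ (trans (sym δ₂≈) (reflexive (≡.sym eqW))) Z<) negZ)

    settled : ∀ Y → δ Y ≡ δ₁ → ¬ Fails (value (t Y - δ Y) (Hᵤ.walkGain (walk Y) - 1#)) → Settled Y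
    settled Y eq ¬fails with compare (t Y - δ Y) 0#
    ... | tri≈ _ f≈0 _ = inj₁ f≈0
    ... | tri> _ _ 0<f = contradiction 0<f (newton-value≤0 (newton-step Y eq) (divergence-nonneg X Y))
    ... | tri< f<0 _ _ with (Hᵤ.walkGain (walk Y) - 1#) <? 0#
    ...   | yes g<0 = inj₂ (f<0 , g<0)
    ...   | no  0≤g = contradiction (f<0 , 0≤g) ¬fails

    Continuation : State → Set (c ⊔ ℓ₁ ⊔ ℓ₂)
    Continuation s = ∃[ Y ] (s ≡ toState Y × Link X Y × Settled Y)

    jump-link : ∀ {f₁ g₁ μ₁ f₂ g₂ μ₂} → ∃ (Answers X δ₁ f₁ g₁ μ₁) →
                Oracle μ₁ δ₂ (value f₂ g₂) μ₂ → Accepted (value f₂ g₂) →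
                Continuation (state δ₂ f₂ g₂ μ₂)
    jump-link {f₂ = f₂} {g₂} {μ₂} (Y , X⊒Y , eqY , _ , _ , ≡.refl) oracle₂ accepted =
      conclude (lookAhead-snapshot Y eqY oracle₂)
      where
      conclude : ∃ (Answers Y δ₂ f₂ g₂ μ₂) → Continuation (state δ₂ f₂ g₂ μ₂)
      conclude (W , Y⊒W , eqW , ≡.refl , ≡.refl , ≡.refl) =
        W , ≡.cong (λ d → state d (t W - δ W) (Hᵤ.walkGain (walk W) - 1#) (labels W)) (≡.sym eqW) ,
        jumped 0<h (λ v → ≤⁺-transitive (Y⊒W v) (X⊒Y v)) negX (double-step W eqW) , inj₂ accepted

    step-link : ∀ {f₁ g₁ μ₁ b μ₂} → ∃ (Answers X δ₁ f₁ g₁ μ₁) → ¬ Fails (value f₁ g₁) →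
                Oracle μ₁ δ₂ b μ₂ → ¬ Accepted b → Continuation (state δ₁ f₁ g₁ μ₁)
    step-link (Y , X⊒Y , eqY , ≡.refl , ≡.refl , ≡.refl) ¬fails oracle₂ ¬accepted =
      Y , ≡.cong (λ d → state d (t Y - δ Y) (Hᵤ.walkGain (walk Y) - 1#) (labels Y)) (≡.sym eqY) ,
      stepped 0<h X⊒Y negX (newton-step Y eqY) (rejected {Y} eqY oracle₂ ¬accepted) , settled Y eqY ¬fails

    iteration-link : ∀ {s} → Iteration (toState X) (continue s) → Continuation s
    iteration-link (jump _ oracle₁ _ oracle₂ accepted) =
      jump-link (oracle-snapshot X δ₁<δ oracle₁) oracle₂ accepted
    iteration-link (step _ oracle₁ ¬fails oracle₂ ¬accepted) =
      step-link (oracle-snapshot X δ₁<δ oracle₁) ¬fails oracle₂ ¬accepted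

    fails? : ∀ b → Dec (Fails b)
    fails? -∞          = yes _
    fails? (value f g) = (f <? 0#) ×-dec (¬? (g <? 0#))

    accepted? : ∀ b → Dec (Accepted b)
    accepted? -∞          = no (λ ())
    accepted? (value f g) = (f <? 0#) ×-dec (g <? 0#)

    f≉0 : f ≉ 0#
    f≉0 f≈0 = <-irrefl f≈0 (proj₁ negX)

    second-query : ∀ {f₁ g₁ μ₁ b μ₂} → Oracle (labels X) δ₁ (value f₁ g₁) μ₁ → ¬ Fails (value f₁ g₁) →
                   Oracle μ₁ δ₂ b μ₂ → Dec (Accepted b) → ∃ (Iteration (toState X))
    second-query {b = value _ _} oracle₁ ¬fails oracle₂ (yes accepted) = _ , jump f≉0 oracle₁ ¬fails oracle₂ accepted
    second-query oracle₁ ¬fails oracle₂ (no ¬accepted) = _ , step f≉0 oracle₁ ¬fails oracle₂ ¬accepted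

    first-query : ∀ {b μ₁} → Oracle (labels X) δ₁ b μ₁ → Dec (Fails b) → ∃ (Iteration (toState X))
    first-query oracle₁ (yes fails) = _ , fail f≉0 oracle₁ fails
    first-query { -∞ } oracle₁ (no ¬fails) = contradiction _ ¬fails
    first-query {value f₁ g₁} {μ₁} oracle₁ (no ¬fails) = conclude (oracle-snapshot X δ₁<δ oracle₁)
      where
      conclude : ∃ (Answers X δ₁ f₁ g₁ μ₁) → ∃ (Iteration (toState X))
      conclude (Y , _ , _ , _ , _ , ≡.refl) with oracle-exists Y δ₂
      ... | b , _ , oracle₂ = second-query oracle₁ ¬fails oracle₂ (accepted? b)

    iteration-exists : ∃ (Iteration (toState X))
    iteration-exists with oracle-exists X δ₁
    ... | b , _ , oracle₁ = first-query oracle₁ (fails? b)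

  terminates-at-root : ∀ {d f g μ k} → f ≈ 0# → TerminatesWithin (ℕ.suc k) (state d f g μ)
  terminates-at-root f≈0 = iterate (_ , stop f≈0) λ where
    (jump f≉0 _ _ _ _) → contradiction f≈0 f≉0
    (step f≉0 _ _ _ _) → contradiction f≈0 f≉0

  -- `k` links have been made and `j` more are allowed. When `j` is zero, `k` exceeds
  -- `history-bound`, so the iterate cannot be negative; the extra unit in `ℕ.suc j` pays for the
  -- iteration that stops at the root.
  terminates : ∀ j {X k} → Settled X → History X k → 3 ℕ.+ 2 ℕ.* (∣ S ∣ ℕ.* 3) ℕ.≤ k ℕ.+ j →
               TerminatesWithin (ℕ.suc j) (toState X)
  terminates j (inj₁ f≈0) _ _ = terminates-at-root f≈0
  terminates ℕ.zero {X} {k} (inj₂ neg) H enough =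
    contradiction (history-bound neg H) (ℕ.<⇒≱ (≡.subst (3 ℕ.+ 2 ℕ.* (∣ S ∣ ℕ.* 3) ℕ.≤_) (ℕ.+-identityʳ k) enough))
  terminates (ℕ.suc j) {X} {k} (inj₂ neg) H enough = iterate (NewtonIteration.iteration-exists X neg) next
    where
    next : ∀ {s} → Iteration (toState X) (continue s) → TerminatesWithin (ℕ.suc j) s
    next iteration with NewtonIteration.iteration-link X neg iteration
    ... | Y , ≡.refl , link , settled =
      terminates j settled (H then link) (≡.subst (3 ℕ.+ 2 ℕ.* (∣ S ∣ ℕ.* 3) ℕ.≤_) (ℕ.+-suc k j) enough)

-- Feasibility at the start and at the end of a phase.

module PhaseFeasibility {c ℓ₁ ℓ₂} (F : OrderedField c ℓ₁ ℓ₂)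
                        {n m : ℕ} (G : M2VPI.System F n m) (S : Subset m) (u : Fin n) where
  open OrderedField F hiding (zero)
  open OrderedFieldProperties F
  open IntegerCoefficients commutativeRing
  open Solver using (_:=_; _:+_; _:*_; _:-_; con) renaming (solve to ring-solve)
  open ExtendedOrder F
  open Tangents F
  open M2VPI F
  open Algorithm G
  open Phase S u
  open System G
  private
    module H          = Subgraph G S
    module Hᵤ         = Subgraph (split u) S
    module GrapevineG = Grapevine F G S
  open Grapevine F (split u) S
  open NewtonPhase F G S u using (isSink; toState; Settled; terminates; terminates-at-root; here)
  open Snapshots F (split u) S (suc u) zero using (Snapshot)

  split-head-u : ∀ {e} → head e ≡ u → System.head (split u) e ≡ zero
  split-head-u {e} eq with head e ≟ u
  ... | yes _ = ≡.refl
  ... | no  ≢ = contradiction eq ≢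

  split-head-other : ∀ {e} → head e ≢ u → System.head (split u) e ≡ suc (head e)
  split-head-other {e} ≢ with head e ≟ u
  ... | yes eq = contradiction eq ≢
  ... | no  _  = ≡.refl

  -- Feasibility for the graph of the previous phase, which has the same arcs
  -- out of the nodes other than u.
  FeasibleOff : Labels n → Set (c ⊔ ℓ₂)
  FeasibleOff y = ∀ {e} → e ∈ S → tail e ≢ u → y (tail e) ≤⁺ H.arcValue y e

  -- If the label comes from a cycle, the minimum over the arcs out of `u` is infinite, so each of
  -- these arcs has value infinity and the bound is trivial.
  initialLabel-≤ : ∀ {y b} → InitialLabel y b → ∀ {e} → e ∈ S → tail e ≡ u → b ≤⁺ H.arcValue y e
  initialLabel-≤ {y} (finite eq) {e} e∈S te =
    ≡.subst (_≤⁺ H.arcValue y e) eq (GrapevineG.bestOut-≤ y e e∈S te)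
  initialLabel-≤ {y} (cycle eq _) {e} e∈S te = ≡.subst (_ ≤⁺_) (≡.sym (≤⁺-top
    (≡.subst (_≤⁺ H.arcValue y e) eq (GrapevineG.bestOut-≤ y e e∈S te)))) (_ ≤⊤⁺)
  initialLabel-≤ {y} (unbounded eq _) {e} e∈S te =
    ≡.subst (_≤⁺ H.arcValue y e) eq (GrapevineG.bestOut-≤ y e e∈S te)

  card-pos : ∀ {e} → e ∈ S → 1 ℕ.≤ ∣ S ∣
  card-pos e∈S = ℕ.≤-trans (ℕ.s≤s ℕ.z≤n) (x∈p⇒∣p-x∣<∣p∣ e∈S)

  -- Needed to absorb the additive constant of the iteration count into a multiple of the number of
  -- arcs.
  initialLabel-card : ∀ {y b} → InitialLabel y [ b ] → 1 ℕ.≤ ∣ S ∣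
  initialLabel-card {y} (finite eq) with GrapevineG.bestOut-attained y u
  ... | inj₂ (_ , e∈S , _) = card-pos e∈S
  ... | inj₁ eq′ with () ← ≡.trans (≡.sym eq) eq′
  initialLabel-card (cycle {[]}    _ ((C≢[] , _) , _))          = contradiction ≡.refl C≢[]
  initialLabel-card (cycle {_ ∷ _} _ ((_ , (e∈S , _) , _) , _)) = card-pos e∈S

  module _ {y : Labels n} (feasible : FeasibleOff y) where

    relabelled-≤ : ∀ {b} → InitialLabel y b → ∀ {e} → e ∈ S → updateAt y u (const b) (tail e) ≤⁺ H.arcValue y e
    relabelled-≤ {b} init {e} e∈S with tail e ≟ u
    ... | yes te = ≡.subst (_≤⁺ H.arcValue y e)
      (≡.sym (≡.trans (≡.cong (updateAt y u (const b)) te) (updateAt-updates u y))) (initialLabel-≤ init e∈S te)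
    ... | no  te = ≡.subst (_≤⁺ H.arcValue y e) (≡.sym (updateAt-minimal (tail e) u y te)) (feasible e∈S te)

    extend-feasible : ∀ {b} → InitialLabel y [ b ] → ∀ {e} → e ∈ S → System.head (split u) e ≢ zero →
                      extend y b (suc (tail e)) ≤⁺ Hᵤ.arcValue (extend y b) e
    extend-feasible {b} init {e} e∈S h≢0 = ≡.subst (extend y b (suc (tail e)) ≤⁺_) value-eq (relabelled-≤ init e∈S)
      where
      head≢u : head e ≢ u
      head≢u eq = h≢0 (split-head-u eq)
      value-eq : H.arcValue y e ≡ Hᵤ.arcValue (extend y b) e
      value-eq = ≡.cong (Maybe.map _) (≡.sym (≡.trans (≡.cong (extend y b) (split-head-other head≢u))
        (updateAt-minimal (head e) u y head≢u)))

    skip-feasible : InitialLabel y ⊤⁺ → GrapevineG.Feasible (updateAt y u (const ⊤⁺))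
    skip-feasible init {e} e∈S = ≤⁺-transitive (relabelled-≤ init e∈S)
      (GrapevineG.arcValue-mono y y′ e raised)
      where
      y′ = updateAt y u (const ⊤⁺)
      raised : y (head e) ≤⁺ y′ (head e)
      raised with head e ≟ u
      ... | yes he = ≡.subst (y (head e) ≤⁺_)
        (≡.sym (≡.trans (≡.cong y′ he) (updateAt-updates u y))) (_ ≤⊤⁺)
      ... | no  he = ≤⁺-reflexive (≡.sym (updateAt-minimal (head e) u y he))

    -- An empty walk means that `u` kept the label `b`, so the value is zero. Otherwise the label of
    -- `u` dropped strictly, which forces the walk to reach u′, and the infeasibility test has
    -- excluded gains of at least one.
    invoked-state : ∀ {s} → Invokes y s →
      State.f s ≈ 0# ⊎ ∃[ X ] (s ≡ toState X × Settled X)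
    invoked-state (invoke {b} {t} {P} init runWalk ¬violated ¬gain≥1 source-eq) = conclude T.progress
      where
      y₀ = extend y b
      z  = run y₀
      z-feasible : Feasible z
      z-feasible = ¬violated⇒feasible {z} ¬violated
      module T = TraceProperties (walk-properties {y₀} {n} z-feasible runWalk)

      y₀-source : y₀ (suc u) ≡ [ b ]
      y₀-source = updateAt-updates u y

      t≤b : t ≤ b
      t≤b = [≤]-injective (≡.subst₂ _≤⁺_ source-eq y₀-source (grapevine-≤ {0} {n} y₀ (suc u) ℕ.z≤n))

      conclude : P ≡ [] ⊎ z (suc u) <⁺ y₀ (suc u) → t - b ≈ 0# ⊎ ∃[ X ] (state b (t - b) (Hᵤ.walkGain P - 1#) z ≡ toState X × Settled X)
      conclude (inj₁ ≡.refl) = inj₁ (trans (+-congʳ (≤-antisym t≤b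
        ([≤]-injective (≡.subst₂ _≤⁺_ y₀-source source-eq T.end)))) (-‿inverseʳ b))
      conclude (inj₂ z<y₀) = inj₂ (snapshot , ≡.refl , inj₂ (f<0 , g<0))
        where
        ends : Hᵤ.endpoint (suc u) P ≡ zero
        ends with walk-ends-at-sink y₀ z P isSink (extend-feasible init) T.tight T.walk T.end
        ... | inj₁ eq = eq
        ... | inj₂ le = contradiction z<y₀ (≤⁺⇒≯⁺ le)

        snapshot : Snapshot
        snapshot = record
          { labels = z ; δ = b ; t = t ; walk = P
          ; sink≡ = grapevine-sink isSink y₀ n ; source≡ = source-eq
          ; feasible = z-feasible ; isWalk = ≡.subst (Hᵤ.IsWalk (suc u) P) ends T.walk
          ; tight = T.tight ; unique = T.unique }

        P≢[] : P ≢ []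
        P≢[] ≡.refl with () ← ends

        t<b : t < b
        t<b = [<]-injective (≡.subst₂ _<⁺_ source-eq y₀-source z<y₀)

        f<0 : t - b < 0#
        f<0 = <-by (<⇒0<- t<b) (ring-solve 2 (λ t b → con (+ 0) :- (t :- b) := b :- t) refl t b)

        gain<1 : Hᵤ.walkGain P < 1#
        gain<1 = decidable-stable (_ <? _) (λ gain≥1 → ¬gain≥1 (P≢[] , gain≥1))

        g<0 : Hᵤ.walkGain P - 1# < 0#
        g<0 = <-by (<⇒0<- gain<1) (ring-solve 1 (λ k → con (+ 0) :- (k :- con (+ 1)) := con (+ 1) :- k) refl _)

    invoked-terminates : ∀ {s} → Invokes y s → TerminatesWithin (10 ℕ.* ∣ S ∣) s
    invoked-terminates {s} inv@(invoke init _ _ _ _) =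
      ≡.subst (λ k → TerminatesWithin k s) (ℕ.suc-pred (10 ℕ.* ∣ S ∣) {{ℕ.>-nonZero (ℕ.≤-trans (ℕ.s≤s ℕ.z≤n) large)}})
        (conclude (invoked-state inv))
      where
      -- The 4 is 3 to exceed `history-bound` plus 1 for the stopping iteration; since `S` is not
      -- empty it is at most 4 per arc.
      large : 4 ℕ.+ 2 ℕ.* (∣ S ∣ ℕ.* 3) ℕ.≤ 10 ℕ.* ∣ S ∣
      large = ℕ.≤-trans (ℕ.+-monoˡ-≤ (2 ℕ.* (∣ S ∣ ℕ.* 3)) (ℕ.*-monoʳ-≤ 4 (initialLabel-card init)))
        (ℕ.≤-reflexive (ℕ-solve 1 (λ k → conⁿ 4 :*ⁿ k :+ⁿ conⁿ 2 :*ⁿ (k :*ⁿ conⁿ 3) :=ⁿ conⁿ 10 :*ⁿ k) ≡.refl ∣ S ∣))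

      conclude : ∀ {s} → State.f s ≈ 0# ⊎ ∃[ X ] (s ≡ toState X × Settled X) →
                 TerminatesWithin (ℕ.suc (ℕ.pred (10 ℕ.* ∣ S ∣))) s
      conclude (inj₁ f≈0) = terminates-at-root f≈0
      conclude (inj₂ (X , ≡.refl , settled)) = terminates _ {X} settled here (ℕ.pred-mono-≤ large)

  -- An invariant without a walk, so it holds after every finite oracle answer, whatever the query.
  -- It suffices to merge u′ back into `u` at a root.
  record Sound (s : State) : Set (c ⊔ ℓ₁ ⊔ ℓ₂) where
    open State s
    field
      {t}      : Carrier
      sink≡    : memory zero ≡ [ δ ]
      source≡  : memory (suc u) ≡ [ t ]
      value≡   : f ≡ t - δ
      feasible : Feasible memory

  oracle-sound : ∀ {μ d f g μ′} → Oracle μ d (value f g) μ′ → Sound (state d f g μ′)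
  oracle-sound {μ} {d} (finite ¬violated eq _) = record
    { sink≡ = grapevine-sink isSink (setSink d μ) n ; source≡ = eq ; value≡ = ≡.refl
    ; feasible = ¬violated⇒feasible {run (setSink d μ)} ¬violated }

  iteration-sound : ∀ {s s′} → Iteration s (continue s′) → Sound s′
  iteration-sound (jump _ _ _ oracle _) = oracle-sound oracle
  iteration-sound (step _ oracle _ _ _) = oracle-sound oracle

  invokes-sound : ∀ {y s} → Invokes y s → Sound s
  invokes-sound {y} (invoke {b} _ _ ¬violated _ eq) = record
    { sink≡ = grapevine-sink isSink (extend y b) n ; source≡ = eq ; value≡ = ≡.refl
    ; feasible = ¬violated⇒feasible {run (extend y b)} ¬violated }

  -- At a root the label of u′ is at most that of `u`, so redirecting arcs from u′ to `u` does not
  -- lower their values.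
  sound-feasible : ∀ {s} → Sound s → State.f s ≈ 0# → GrapevineG.Feasible (State.memory s ∘ suc)
  sound-feasible {state d f g z} sound f≈0 {e} e∈S = ≤⁺-transitive (feasible e∈S) merged
    where
    open Sound sound
    d≤t : d ≤ t
    d≤t = ≤-by (≤-reflexive refl) (trans (reflexive (≡.sym value≡)) f≈0)

    lower : z (System.head (split u) e) ≤⁺ z (suc (head e))
    lower with head e ≟ u
    ... | yes he = ≡.subst₂ _≤⁺_ (≡.sym sink≡) (≡.sym (≡.trans (≡.cong (z ∘ suc) he) source≡)) [ d≤t ]
    ... | no  _  = ≤⁺-refl

    merged : Hᵤ.arcValue z e ≤⁺ H.arcValue (z ∘ suc) e
    merged with z (System.head (split u) e) | z (suc (head e)) | lower
    ... | _ | _ | _ ≤⊤⁺ = _ ≤⊤⁺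
    ... | _ | _ | [ p ] = [ ≤-by (0≤*0≤ (<⇒≤ (gain-pos e)) (≤⇒0≤- p))
      (ring-solve 4 (λ a g s t → a :+ g :* t :- (a :+ g :* s) := g :* (t :- s)) refl (cost e) (gain e) _ _) ]

  root-feasible : ∀ {s d z} → Sound s → ReturnsRoot s d z → GrapevineG.Feasible (z ∘ suc)
  root-feasible sound (now (stop f≈0))   = sound-feasible sound f≈0
  root-feasible sound (later it returns) = root-feasible (iteration-sound it) returns

  completes-feasible : ∀ {y y′} → FeasibleOff y → Completes y y′ → GrapevineG.Feasible y′
  completes-feasible feasible (skip init)       = skip-feasible feasible init
  completes-feasible feasible (solve inv returns) = root-feasible (invokes-sound inv) returns

-- The feasibility invariant through the phases.

module _ {c ℓ₁ ℓ₂} (F : OrderedField c ℓ₁ ℓ₂) {n m : ℕ} (G : M2VPI.System F n m) where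
  open M2VPI F
  open Algorithm G
  open System G

  ∈δ⁺⇒tail≡ : ∀ {e u} → e ∈ δ⁺ u → tail e ≡ u
  ∈δ⁺⇒tail≡ {e} {u} e∈ with tail e ≟ u | ≡.trans (≡.sym (lookup∘tabulate (λ e → does (tail e ≟ u)) e)) ([]=⇒lookup e∈)
  ... | yes eq | _ = eq

  feasible-off : ∀ {S y u} → Grapevine.Feasible F G S y → PhaseFeasibility.FeasibleOff F G (S ∪ δ⁺ u) u y
  feasible-off {S} {y} {u} feasible e∈ te with x∈p∪q⁻ S (δ⁺ u) e∈
  ... | inj₁ e∈S  = feasible e∈S
  ... | inj₂ e∈δ⁺ = contradiction (∈δ⁺⇒tail≡ e∈δ⁺) te

  -- Induction over the phases: the arcs added in a phase all leave its node `u`, and these are the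
  -- arcs that `FeasibleOff` exempts.
  reached-feasible : ∀ {A S y} → Reached A S y → Grapevine.Feasible F G S y
  reached-feasible start e∈⊥ = contradiction e∈⊥ ∉⊥
  reached-feasible (phase {S = S} {y} {y′} {u} reached _ completes) =
    PhaseFeasibility.completes-feasible F G (S ∪ δ⁺ u) u (feasible-off {S} {y} (reached-feasible reached)) completes

open import Data.Nat.Base using (_*_)

theorem4p11 : ∀ {c ℓ₁ ℓ₂ : Level} → ∃[ K ] (∀ (F : OrderedField c ℓ₁ ℓ₂) →
    let open M2VPI F in
    ∀ (n m : ℕ) (G : System n m) →
    let open Algorithm G in
    ∀ (A : Subset n) (S : Subset m) (y : Labels n) → Reached A S y →
    ∀ (u : Fin n) → u ∉ A →
    let Sᵏ = S ∪ δ⁺ u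
        open Phase Sᵏ u in
    ∀ (s : State) → Invokes y s → TerminatesWithin (K * ∣ Sᵏ ∣) s)
theorem4p11 = 10 , λ F n m G A S y reached u _ s invokes →
  PhaseFeasibility.invoked-terminates F G (S ∪ M2VPI.Algorithm.δ⁺ F G u) u
    (feasible-off F G {S} {y} (reached-feasible F G reached)) invokes
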